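{- Let $p,q,r$ be integers $\ge 3$ that are pairwise relatively prime, and let $s\ge 1$ be an integer with $r\equiv s\pmod{pq}$ or $r\equiv -s\pmod{pq}$, and $r>\max(p,q)>s\ge 1$. Then \[ A(p,q,s)\le A(p,q,r)\le A(p,q,s)+1 . \]
   Context: For pairwise relatively prime integers $p,q,r\ge 3$, the ternary inclusion-exclusion polynomial is \[ Q_{\{p,q,r\}}(z)=\frac{(z^{pqr}-1)(z^p-1)(z^q-1)(z^r-1)}{(z^{pq}-1)(z^{qr}-1)(z^{rp}-1)(z-1)}, \] a polynomial with integer coefficients $a_m$, and $A(p,q,r)=\max_m |a_m|$ is the maximum absolute value of its coefficients. The function $A$ is symmetric in its three arguments. By convention, for $s=1$ or $s=2$ (with $p,q,s$ pairwise relatively prime) one sets $A(p,q,s)=s-1$. (Under the hypotheses, $\gcd(s,pq)=1$, so $p,q,s$ are pairwise relatively prime; when $s\ge 3$, $A(p,q,s)$ is defined by the polynomial above.) -}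

module Defs where

open import Data.Nat as ℕ using (ℕ; zero; suc; _≤ᵇ_; _≡ᵇ_; _⊔_; _*_; _∸_)
open import Data.Integer as ℤ using (ℤ; +_; -_; ∣_∣)
open import Data.Bool using (if_then_else_)
open import Data.List using (foldr; map; upTo)

-- Integer polynomials represented by their coefficient functions ℕ → ℤ
-- (coefficient of z^i at index i); all polynomials used have finite support.
Poly : Set
Poly = ℕ → ℤ

sumBelow : ℕ → (ℕ → ℤ) → ℤ
sumBelow zero    f = + 0
sumBelow (suc n) f = sumBelow n f ℤ.+ f n

-- z^n - 1  (for n ≥ 1)
zpowMinusOne : ℕ → Poly
zpowMinusOne n i =
  if i ≡ᵇ n then + 1 else (if i ≡ᵇ 0 then - (+ 1) else + 0)

_⊛_ : Poly → Poly → Poly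
(f ⊛ g) m = sumBelow (suc m) (λ i → f i ℤ.* g (m ∸ i))

-- Exact division by z^n - 1 (n ≥ 1) of a polynomial f of degree ≤ B:
-- if f = g (z^n - 1) then g_j = Σ_{k ≥ 1} f_{j + k n}, and the terms with k > B vanish.
divZpowMinusOne : ℕ → ℕ → Poly → Poly
divZpowMinusOne B n f j = sumBelow B (λ k → f (j ℕ.+ suc k * n))

numDeg : ℕ → ℕ → ℕ → ℕ
numDeg p q r = p * q * r ℕ.+ p ℕ.+ q ℕ.+ r

Qpoly : ℕ → ℕ → ℕ → Poly
Qpoly p q r =
  divZpowMinusOne B 1
    (divZpowMinusOne B (r * p)
      (divZpowMinusOne B (q * r)
        (divZpowMinusOne B (p * q) numer)))
  where
  B = numDeg p q r
  numer = ((zpowMinusOne (p * q * r) ⊛ zpowMinusOne p) ⊛ zpowMinusOne q) ⊛ zpowMinusOne r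

-- max_m |a_m| over all coefficients (all m ≤ numDeg, beyond which coefficients vanish)
Apoly : ℕ → ℕ → ℕ → ℕ
Apoly p q r = foldr _⊔_ 0 (map (λ m → ∣ Qpoly p q r m ∣) (upTo (suc (numDeg p q r))))

-- A(p,q,s) with the convention A(p,q,s) = s - 1 for s ∈ {1,2}
-- (and also 0 for s = 0, which never arises)
A : ℕ → ℕ → ℕ → ℕ
A p q s = if s ≤ᵇ 2 then s ∸ 1 else Apoly p q s

{-# OPTIONS --safe #-}
module Submission where

-- As a power series Q_{p,q,s}(z) = Q_{p,q}(z^s) χ(z) with
-- χ = (1 - z^p)(1 - z^q) / ((1 - z)(1 - z^{pq})), so its coefficient at s k + t, t < s, is
-- S_s(k,t) = Σ_{i ≤ k} c_i χ_{s(k-i)+t}, where c_i are the coefficients of Q_{p,q}. As χ_m depends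
-- only on m mod pq and is odd under m ↦ p + q - 1 - m, replacing s by r ≡ ± s turns
-- S_s(k,t) into ± S_r(k,t') for a suitable t'; this gives the lower bound, and it reduces
-- the upper bound to estimating S_s(k,t) for all t < pq. Let p < q. If t < q, then S_s(k,t)
-- differs from the coefficient at s k + t by a sum of consecutive c_i; if q ≤ t, the same holds
-- with s k + t - pq. Such a sum of c_i is a difference of two coefficients of Q_{p,q} / (1 - z),
-- all of which are 0 or 1.

open import Defs
open import Data.Bool using (if_then_else_)
open import Data.Empty using (⊥; ⊥-elim)
open import Data.Integer as ℤ using (ℤ; 0ℤ; 1ℤ; -1ℤ)
import Data.Integer.Properties as ℤP
open import Data.Integer.Tactic.RingSolver using (solve-∀)
open import Data.List using (List; []; _∷_; foldr; map; upTo)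
open import Data.List.Membership.Propositional using (_∈_)
open import Data.List.Membership.Propositional.Properties using (∈-upTo⁺)
open import Data.List.Relation.Binary.Permutation.Propositional as Perm using (_↭_; prep; swap; ↭-refl; ↭-sym; ↭-trans)
import Data.List.Relation.Binary.Permutation.Propositional.Properties as PermP
open import Data.List.Relation.Unary.All using (All; []; _∷_)
open import Data.List.Relation.Unary.Any using (here; there)
open import Data.Nat using (ℕ; zero; suc; _+_; _*_; _∸_; _≤_; _<_; _⊔_; z≤n; s≤s; s≤s⁻¹; >-nonZero; _<?_; _≤?_; _/_; _%_; _≡ᵇ_)
open import Data.Nat.Coprimality as Coprimality using (Coprime; coprime-Bézout; coprime-divisor)
open import Data.Nat.Divisibility using (_∣_; divides; ∣m+n∣m⇒∣n; ∣m∣n⇒∣m+n; ∣-refl; ∣-trans; m∣m*n; n∣m*n; _∣0; ∣⇒≤)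
open import Data.Nat.DivMod using (m≡m%n+[m/n]*n; m%n<n)
open import Data.Nat.GCD using (module Bézout)
open import Data.Nat.Properties
import Data.Nat.Tactic.RingSolver as ℕSolver
open import Data.Product using (_×_; _,_; ∃-syntax; proj₁; proj₂)
open import Data.Sum using (_⊎_; inj₁; inj₂)
open import Algebra.Properties.AbelianGroup ℤP.+-0-abelianGroup using (∙-cancelʳ)
open import Relation.Binary using (tri<; tri≈; tri>)
open import Relation.Binary.PropositionalEquality
open import Relation.Nullary using (yes; no)

-- Operators on power series

-- Small s does not fit the general estimate. At s = 1 the series is the constant 1, whereas the
-- convention gives the value 0; the general bound would be one too weak, so |S_1(k,t)| ≤ 1 is
-- proved directly, and the one dangerous index is settled by the Frobenius number pq - p - q. At s
-- = 2 the series is Q_{p,q}(-z), whose coefficients are at most 1 in absolute value, in agreement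
-- with the convention. Identities are proved by clearing denominators: multiplication by 1 - z^n is
-- injective on power series. Thus F is the unique solution of the cleared defining equation, and
-- its symmetry and the cases s = 1, 2 are checks of that equation. `Qpoly` divides by sums
-- truncated at a degree bound, so the finite support of F has to be established. A polynomial over
-- 1 - z^n is ultimately n-periodic; the periods pq, qs, sp together make F ultimately constant, and
-- a further argument makes that constant 0.

sum-cong : ∀ n {f g : Poly} → (∀ i → i < n → f i ≡ g i) → sumBelow n f ≡ sumBelow n g
sum-cong zero    h = refl
sum-cong (suc n) h = cong₂ ℤ._+_ (sum-cong n (λ i i<n → h i (m<n⇒m<1+n i<n))) (h n ≤-refl)

sum-zero : ∀ n {f : Poly} → (∀ i → i < n → f i ≡ 0ℤ) → sumBelow n f ≡ 0ℤ
sum-zero zero    h = refl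
sum-zero (suc n) h = cong₂ ℤ._+_ (sum-zero n (λ i i<n → h i (m<n⇒m<1+n i<n))) (h n ≤-refl)

sum-linear : ∀ n a b (f g : Poly) →
  sumBelow n (λ i → a ℤ.* f i ℤ.+ b ℤ.* g i) ≡ a ℤ.* sumBelow n f ℤ.+ b ℤ.* sumBelow n g
sum-linear zero    a b f g = base a b
  where
  base : ∀ a b → 0ℤ ≡ a ℤ.* 0ℤ ℤ.+ b ℤ.* 0ℤ
  base = solve-∀
sum-linear (suc n) a b f g = trans (cong (λ x → x ℤ.+ (a ℤ.* f n ℤ.+ b ℤ.* g n)) (sum-linear n a b f g))
  (step a b (sumBelow n f) (sumBelow n g) (f n) (g n))
  where
  step : ∀ a b x y u v → (a ℤ.* x ℤ.+ b ℤ.* y) ℤ.+ (a ℤ.* u ℤ.+ b ℤ.* v) ≡ a ℤ.* (x ℤ.+ u) ℤ.+ b ℤ.* (y ℤ.+ v)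
  step = solve-∀

sum-++ : ∀ m n (f : Poly) → sumBelow (m + n) f ≡ sumBelow m f ℤ.+ sumBelow n (λ i → f (m + i))
sum-++ m zero    f = trans (cong (λ k → sumBelow k f) (+-identityʳ m)) (sym (ℤP.+-identityʳ _))
sum-++ m (suc n) f = trans (cong (λ k → sumBelow k f) (+-suc m n))
  (trans (cong (ℤ._+ f (m + n)) (sum-++ m n f)) (ℤP.+-assoc (sumBelow m f) _ _))

sum-extend : ∀ {m n} {f : Poly} → m ≤ n → (∀ i → m ≤ i → f i ≡ 0ℤ) → sumBelow n f ≡ sumBelow m f
sum-extend {m} {n} {f} m≤n h = trans (cong (λ k → sumBelow k f) (sym (m+[n∸m]≡n m≤n)))
  (trans (sum-++ m (n ∸ m) f)
  (trans (cong (λ x → sumBelow m f ℤ.+ x) (sum-zero (n ∸ m) (λ i _ → h (m + i) (m≤m+n m i)))) (ℤP.+-identityʳ _)))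

-- Multiplication of a power series by z^n.
shift : ℕ → Poly → Poly
shift zero    f m       = f m
shift (suc n) f zero    = 0ℤ
shift (suc n) f (suc m) = shift n f m

shift-cong : ∀ n {f g : Poly} → f ≗ g → shift n f ≗ shift n g
shift-cong zero    h m       = h m
shift-cong (suc n) h zero    = refl
shift-cong (suc n) h (suc m) = shift-cong n h m

shift-cancel : ∀ a x (f : Poly) t → shift (a + x) f (a + t) ≡ shift x f t
shift-cancel zero    x f t = refl
shift-cancel (suc a) x f t = shift-cancel a x f t

shift-hit : ∀ a (f : Poly) t → shift a f (a + t) ≡ f t
shift-hit zero    f t = refl
shift-hit (suc a) f t = shift-hit a f t

shift-∸ : ∀ {a m} (f : Poly) → a ≤ m → shift a f m ≡ f (m ∸ a)
shift-∸ f z≤n       = refl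
shift-∸ f (s≤s a≤m) = shift-∸ f a≤m

shift-< : ∀ {a m} (f : Poly) → m < a → shift a f m ≡ 0ℤ
shift-< {suc a} {zero}  f _         = refl
shift-< {suc a} {suc m} f (s≤s m<a) = shift-< f m<a

shift-+ : ∀ a b (f : Poly) → shift a (shift b f) ≗ shift (a + b) f
shift-+ zero    b f m       = refl
shift-+ (suc a) b f zero    = refl
shift-+ (suc a) b f (suc m) = shift-+ a b f m

shift-comm : ∀ a b (f : Poly) → shift a (shift b f) ≗ shift b (shift a f)
shift-comm a b f m = trans (shift-+ a b f m)
  (trans (cong (λ k → shift k f m) (+-comm a b)) (sym (shift-+ b a f m)))

shift-linear : ∀ n a b (f g : Poly) →
  shift n (λ i → a ℤ.* f i ℤ.+ b ℤ.* g i) ≗ (λ i → a ℤ.* shift n f i ℤ.+ b ℤ.* shift n g i)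
shift-linear zero    a b f g m       = refl
shift-linear (suc n) a b f g (suc m) = shift-linear n a b f g m
shift-linear (suc n) a b f g zero    = base a b
  where
  base : ∀ a b → 0ℤ ≡ a ℤ.* 0ℤ ℤ.+ b ℤ.* 0ℤ
  base = solve-∀

δ ones : Poly
δ zero    = 1ℤ
δ (suc _) = 0ℤ
ones _ = 1ℤ

-- box n = 1 + z + ⋯ + z^(n-1)
box : ℕ → Poly
box zero    _       = 0ℤ
box (suc n) zero    = 1ℤ
box (suc n) (suc m) = box n m

box-< : ∀ {n m} → m < n → box n m ≡ 1ℤ
box-< {suc n} {zero}  _         = refl
box-< {suc n} {suc m} (s≤s m<n) = box-< m<n

box-≥ : ∀ {n m} → n ≤ m → box n m ≡ 0ℤ
box-≥ z≤n       = refl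
box-≥ (s≤s n≤m) = box-≥ n≤m

opaque
  -- Opaque, like the product below, so that unification can invert it.
  binom : ℤ → ℤ → ℕ → Poly → Poly
  binom a b n f m = a ℤ.* f m ℤ.+ b ℤ.* shift n f m

-- Multiplication by 1 - z^n, 1 + z^n and z^n - 1. As instances of one operator they share the
-- congruence and commutation laws.
E P M : ℕ → Poly → Poly
E = binom 1ℤ -1ℤ
P = binom 1ℤ 1ℤ
M = binom -1ℤ 1ℤ

opaque
  unfolding binom

  binom-cong : ∀ a b n {f g : Poly} → f ≗ g → binom a b n f ≗ binom a b n g
  binom-cong a b n h m = cong₂ (λ x y → a ℤ.* x ℤ.+ b ℤ.* y) (h m) (shift-cong n h m)

  E-cong : ∀ n {f g : Poly} → f ≗ g → E n f ≗ E n g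
  E-cong = binom-cong 1ℤ -1ℤ

  shift-binom : ∀ k a b n (f : Poly) → shift k (binom a b n f) ≗ binom a b n (shift k f)
  shift-binom k a b n f m = trans (shift-linear k a b f (shift n f) m)
    (cong (λ x → a ℤ.* shift k f m ℤ.+ b ℤ.* x) (shift-comm k n f m))

  binom-comm : ∀ a b m c d n (f : Poly) → binom a b m (binom c d n f) ≗ binom c d n (binom a b m f)
  binom-comm a b m c d n f i =
    trans (cong (λ x → a ℤ.* binom c d n f i ℤ.+ b ℤ.* x) (shift-binom m c d n f i))
    (trans (ring a b c d (f i) (shift n f i) (shift m f i) (shift n (shift m f) i))
    (cong (λ x → c ℤ.* binom a b m f i ℤ.+ d ℤ.* x) (sym (shift-linear n a b f (shift m f) i))))
    where
    ring : ∀ a b c d x y u v →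
      a ℤ.* (c ℤ.* x ℤ.+ d ℤ.* y) ℤ.+ b ℤ.* (c ℤ.* u ℤ.+ d ℤ.* v) ≡
      c ℤ.* (a ℤ.* x ℤ.+ b ℤ.* u) ℤ.+ d ℤ.* (a ℤ.* y ℤ.+ b ℤ.* v)
    ring = solve-∀

  E-comm : ∀ m n (f : Poly) → E m (E n f) ≗ E n (E m f)
  E-comm m n = binom-comm 1ℤ -1ℤ m 1ℤ -1ℤ n

  E-value : ∀ n (f : Poly) m → E n f m ≡ f m ℤ.- shift n f m
  E-value n f m = ring (f m) (shift n f m)
    where
    ring : ∀ x y → 1ℤ ℤ.* x ℤ.+ -1ℤ ℤ.* y ≡ x ℤ.- y
    ring = solve-∀

  E-solve : ∀ n (f : Poly) m → f m ≡ E n f m ℤ.+ shift n f m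
  E-solve n f m = ring (f m) (shift n f m)
    where
    ring : ∀ x y → x ≡ (1ℤ ℤ.* x ℤ.+ -1ℤ ℤ.* y) ℤ.+ y
    ring = solve-∀

  -- The coefficient of f at m is that of `E n f` plus an earlier coefficient of f, because n ≥ 1;
  -- strong induction on m then determines f.
  E-injective : ∀ n {f g : Poly} → 1 ≤ n → E n f ≗ E n g → f ≗ g
  E-injective n {f} {g} 1≤n h m = below (suc m) m ≤-refl
    where
    shift-eq : ∀ k → (∀ i → i < k → f i ≡ g i) → shift n f k ≡ shift n g k
    shift-eq k ih with n ≤? k
    ... | yes n≤k = trans (shift-∸ f n≤k)
            (trans (ih (k ∸ n) (∸-monoʳ-< {k} {n} {0} 1≤n n≤k)) (sym (shift-∸ g n≤k)))
    ... | no  n≰k = trans (shift-< f (≰⇒> n≰k)) (sym (shift-< g (≰⇒> n≰k)))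
    below : ∀ k i → i < k → f i ≡ g i
    below (suc k) i (s≤s i≤k) = trans (E-solve n f i)
      (trans (cong₂ ℤ._+_ (h i) (shift-eq i (λ j j<i → below k j (<-≤-trans j<i i≤k))))
      (sym (E-solve n g i)))

  E1-ones : E 1 ones ≗ δ
  E1-ones zero    = refl
  E1-ones (suc m) = refl

  box-ones : ∀ n → box n ≗ E n ones
  box-ones zero    m       = refl
  box-ones (suc n) zero    = refl
  box-ones (suc n) (suc m) = box-ones n m

E1-box : ∀ n → E 1 (box n) ≗ E n δ
E1-box n m = trans (E-cong 1 (box-ones n) m) (trans (E-comm 1 n ones m) (E-cong n E1-ones m))

infix 8 _⟨z^_⟩·_

opaque
  -- The product c(z^s) f(z); the sum is correctly truncated for s ≥ 1.
  _⟨z^_⟩·_ : Poly → ℕ → Poly → Poly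
  (c ⟨z^ s ⟩· f) n = sumBelow (suc n) (λ i → c i ℤ.* shift (s * i) f n)

term-vanish : ∀ {s} (c f : Poly) n i → 1 ≤ s → n < i → c i ℤ.* shift (s * i) f n ≡ 0ℤ
term-vanish {s} c f n i 1≤s n<i = trans
  (cong (c i ℤ.*_) (shift-< f (<-≤-trans n<i (≤-trans (≤-reflexive (sym (*-identityˡ i))) (*-monoˡ-≤ i 1≤s)))))
  (ℤP.*-zeroʳ (c i))

opaque
  unfolding binom _⟨z^_⟩·_

  -- Since s ≥ 1, the terms with i > n vanish. Sums with different truncations can therefore be
  -- compared.
  act-extend : ∀ {s} (c f : Poly) {n L} → 1 ≤ s → n < L →
    sumBelow L (λ i → c i ℤ.* shift (s * i) f n) ≡ (c ⟨z^ s ⟩· f) n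
  act-extend c f {n} 1≤s n<L = sum-extend n<L (λ i n<i → term-vanish c f n i 1≤s n<i)

  act-cong : ∀ s {c d f g : Poly} → c ≗ d → f ≗ g → c ⟨z^ s ⟩· f ≗ d ⟨z^ s ⟩· g
  act-cong s h k n = sum-cong (suc n) (λ i _ → cong₂ ℤ._*_ (h i) (shift-cong (s * i) k n))

  shift-act : ∀ {s} m (c f : Poly) → 1 ≤ s →
    shift m (c ⟨z^ s ⟩· f) ≗ (c ⟨z^ s ⟩· shift m f)
  shift-act {s} m c f 1≤s n with m ≤? n
  ... | no  m≰n = trans (shift-< _ (≰⇒> m≰n)) (sym (sum-zero (suc n) (λ i _ →
          trans (cong (c i ℤ.*_) (trans (shift-comm (s * i) m f n) (shift-< _ (≰⇒> m≰n)))) (ℤP.*-zeroʳ (c i)))))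
  ... | yes m≤n = trans (shift-∸ _ m≤n)
          (trans (sym (act-extend c f 1≤s (s≤s (m∸n≤m n m))))
          (sum-cong (suc n) (λ i _ → cong (c i ℤ.*_)
            (sym (trans (shift-comm (s * i) m f n) (shift-∸ _ m≤n))))))

  act-binomʳ : ∀ {s} a b m (c f : Poly) → 1 ≤ s →
    c ⟨z^ s ⟩· binom a b m f ≗ binom a b m (c ⟨z^ s ⟩· f)
  act-binomʳ {s} a b m c f 1≤s n = trans
    (sum-cong (suc n) (λ i _ → trans (cong (c i ℤ.*_) (shift-linear (s * i) a b f (shift m f) n))
      (ring (c i) a b _ _)))
    (trans (sum-linear (suc n) a b _ _)
    (cong (λ x → a ℤ.* (c ⟨z^ s ⟩· f) n ℤ.+ b ℤ.* x) (sym (shift-act m c f 1≤s n))))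
    where
    ring : ∀ c a b x y → c ℤ.* (a ℤ.* x ℤ.+ b ℤ.* y) ≡ a ℤ.* (c ℤ.* x) ℤ.+ b ℤ.* (c ℤ.* y)
    ring = solve-∀

  act-shiftˡ : ∀ {s} m (c f : Poly) → 1 ≤ s →
    shift m c ⟨z^ s ⟩· f ≗ shift (s * m) (c ⟨z^ s ⟩· f)
  act-shiftˡ {s} m c f 1≤s n = trans (sym (act-extend (shift m c) f 1≤s (m≤n+m (suc n) m)))
    (trans (sum-++ m (suc n) _)
    (trans (cong₂ ℤ._+_
       (sum-zero m (λ i i<m → trans (cong (ℤ._* shift (s * i) f n) (shift-< c i<m)) (ℤP.*-zeroˡ (shift (s * i) f n))))
       (sum-cong (suc n) (λ i _ → cong₂ ℤ._*_ (shift-hit m c i) (index i))))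
    (trans (ℤP.+-identityˡ _) (sym (shift-act (s * m) c f 1≤s n)))))
    where
    index : ∀ i → shift (s * (m + i)) f n ≡ shift (s * i) (shift (s * m) f) n
    index i = trans (cong (λ k → shift k f n) (trans (*-distribˡ-+ s m i) (+-comm (s * m) (s * i))))
      (sym (shift-+ (s * i) (s * m) f n))

  act-binomˡ : ∀ {s} a b m (c f : Poly) → 1 ≤ s →
    binom a b m c ⟨z^ s ⟩· f ≗ binom a b (s * m) (c ⟨z^ s ⟩· f)
  act-binomˡ {s} a b m c f 1≤s n = trans
    (sum-cong (suc n) (λ i _ → ring a b (c i) (shift m c i) _))
    (trans (sum-linear (suc n) a b _ _)
    (cong (λ x → a ℤ.* (c ⟨z^ s ⟩· f) n ℤ.+ b ℤ.* x) (act-shiftˡ m c f 1≤s n)))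
    where
    ring : ∀ a b x y u → (a ℤ.* x ℤ.+ b ℤ.* y) ℤ.* u ≡ a ℤ.* (x ℤ.* u) ℤ.+ b ℤ.* (y ℤ.* u)
    ring = solve-∀

act-Eʳ : ∀ {s} m (c f : Poly) → 1 ≤ s → c ⟨z^ s ⟩· E m f ≗ E m (c ⟨z^ s ⟩· f)
act-Eʳ = act-binomʳ 1ℤ -1ℤ

act-Eˡ : ∀ {s} m (c f : Poly) → 1 ≤ s → E m c ⟨z^ s ⟩· f ≗ E (s * m) (c ⟨z^ s ⟩· f)
act-Eˡ = act-binomˡ 1ℤ -1ℤ

opaque
  unfolding _⟨z^_⟩·_

  act-δˡ : ∀ s (f : Poly) → δ ⟨z^ s ⟩· f ≗ f
  act-δˡ s f n = go n
    where
    go : ∀ k → sumBelow (suc k) (λ i → δ i ℤ.* shift (s * i) f n) ≡ f n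
    go zero    = trans (ℤP.+-identityˡ _) (trans (ℤP.*-identityˡ _) (cong (λ j → shift j f n) (*-zeroʳ s)))
    go (suc k) = trans (cong₂ ℤ._+_ (go k) (ℤP.*-zeroˡ (shift (s * suc k) f n))) (ℤP.+-identityʳ _)

  act-δʳ : ∀ (c : Poly) → c ⟨z^ 1 ⟩· δ ≗ c
  act-δʳ c n = trans (cong₂ ℤ._+_ (sum-zero n (λ i i<n → trans (cong (c i ℤ.*_) (off i i<n)) (ℤP.*-zeroʳ (c i)))) last)
      (ℤP.+-identityˡ _)
    where
    δ-pos : ∀ {m} → 0 < m → δ m ≡ 0ℤ
    δ-pos (s≤s _) = refl
    off : ∀ i → i < n → shift (1 * i) δ n ≡ 0ℤ
    off i i<n = trans (cong (λ k → shift k δ n) (*-identityˡ i)) (trans (shift-∸ δ (<⇒≤ i<n)) (δ-pos (m<n⇒0<n∸m i<n)))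
    last : c n ℤ.* shift (1 * n) δ n ≡ c n
    last = trans (cong (c n ℤ.*_) (trans (cong (λ k → shift k δ n) (*-identityˡ n))
      (trans (shift-∸ {n} δ ≤-refl) (cong δ (n∸n≡0 n))))) (ℤP.*-identityʳ (c n))

-- The series `ones ⟨z^ n ⟩· f` is f / (1 - z^n), by substituting z^n into 1 / (1 - z).
E-geometric : ∀ {n} (f : Poly) → 1 ≤ n → E n (ones ⟨z^ n ⟩· f) ≗ f
E-geometric {n} f 1≤n m = trans (cong (λ k → E k (ones ⟨z^ n ⟩· f) m) (sym (*-identityʳ n)))
  (trans (sym (act-Eˡ 1 ones f 1≤n m)) (trans (act-cong n E1-ones (λ _ → refl) m) (act-δˡ n f m)))

-- Products of factors 1 - z^n are kept as lists, so that reordering them is a permutation.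
Es : List ℕ → Poly → Poly
Es ns f = foldr E f ns

Es-cong : ∀ ns {f g : Poly} → f ≗ g → Es ns f ≗ Es ns g
Es-cong []       h = h
Es-cong (n ∷ ns) h = E-cong n (Es-cong ns h)

Es-↭ : ∀ {ns ms} (f : Poly) → ns ↭ ms → Es ns f ≗ Es ms f
Es-↭ f Perm.refl        m = refl
Es-↭ f (prep n r)       m = E-cong n (Es-↭ f r) m
Es-↭ {a ∷ b ∷ ns} f (swap a b r) m = trans (E-comm a b (Es ns f) m) (E-cong b (E-cong a (Es-↭ f r)) m)
Es-↭ f (Perm.trans r t) m = trans (Es-↭ f r m) (Es-↭ f t m)

Es-injective : ∀ {ns} {f g : Poly} → All (1 ≤_) ns → Es ns f ≗ Es ns g → f ≗ g
Es-injective                []         h = h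
Es-injective {n ∷ ns} {f} {g} (1≤n ∷ all) h = Es-injective all (E-injective n 1≤n h)

-- Polynomials and ultimately periodic series

Vanishes : Poly → Set
Vanishes f = ∃[ N ] (∀ n → N ≤ n → f n ≡ 0ℤ)

vanishes-cong : ∀ {f g : Poly} → f ≗ g → Vanishes g → Vanishes f
vanishes-cong h (N , v) = N , λ n N≤n → trans (h n) (v n N≤n)

shift-vanish : ∀ a {N} {f : Poly} → (∀ n → N ≤ n → f n ≡ 0ℤ) → ∀ n → a + N ≤ n → shift a f n ≡ 0ℤ
shift-vanish a {N} {f} v n a+N≤n = trans (shift-∸ f (≤-trans (m≤m+n a N) a+N≤n))
  (v (n ∸ a) (subst (_≤ n ∸ a) (m+n∸m≡n a N) (∸-monoˡ-≤ a a+N≤n)))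

vanishes-E : ∀ a {f} → Vanishes f → Vanishes (E a f)
vanishes-E a {f} (N , v) = a + N , λ n a+N≤n → trans (E-value a f n)
  (cong₂ ℤ._-_ (v n (≤-trans (m≤n+m N a) a+N≤n)) (shift-vanish a v n a+N≤n))

opaque
  unfolding _⟨z^_⟩·_

  vanishes-act : ∀ s {c f} → Vanishes c → Vanishes f → Vanishes (c ⟨z^ s ⟩· f)
  vanishes-act s {c} {f} (K , u) (N , v) = s * K + N , λ n le → sum-zero (suc n) (λ i _ → term n le i)
    where
    term : ∀ n → s * K + N ≤ n → ∀ i → c i ℤ.* shift (s * i) f n ≡ 0ℤ
    term n le i with K ≤? i
    ... | yes K≤i = trans (cong (ℤ._* shift (s * i) f n) (u i K≤i)) (ℤP.*-zeroˡ (shift (s * i) f n))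
    ... | no  K≰i = trans (cong (c i ℤ.*_) (shift-vanish (s * i) v n
            (≤-trans (+-monoˡ-≤ N (*-monoʳ-≤ s (<⇒≤ (≰⇒> K≰i)))) le))) (ℤP.*-zeroʳ (c i))

vanishes-δ : Vanishes δ
vanishes-δ = 1 , λ { (suc n) _ → refl }

vanishes-box : ∀ n → Vanishes (box n)
vanishes-box n = n , λ m → box-≥

PeriodicFrom : ℕ → ℕ → Poly → Set
PeriodicFrom N m f = ∀ n → N ≤ n → f (m + n) ≡ f n

UltimatelyPeriodic : ℕ → Poly → Set
UltimatelyPeriodic m f = ∃[ N ] PeriodicFrom N m f

periodic-cong : ∀ {m} {f g : Poly} → f ≗ g → UltimatelyPeriodic m g → UltimatelyPeriodic m f
periodic-cong {m} h (N , per) = N , λ n N≤n → trans (h (m + n)) (trans (per n N≤n) (sym (h n)))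

E-vanishes⇒periodic : ∀ m {f} → Vanishes (E m f) → UltimatelyPeriodic m f
E-vanishes⇒periodic m {f} (N , v) = N , λ n N≤n → trans (E-solve m f (m + n))
  (trans (cong₂ ℤ._+_ (v (m + n) (≤-trans N≤n (m≤n+m n m))) (shift-hit m f n)) (ℤP.+-identityˡ (f n)))

periodic⇒E-vanishes : ∀ m f → UltimatelyPeriodic m f → Vanishes (E m f)
periodic⇒E-vanishes m f (N , per) = m + N , λ n m+N≤n →
  let m≤n = ≤-trans (m≤m+n m N) m+N≤n
      N≤n∸m = subst (_≤ n ∸ m) (m+n∸m≡n m N) (∸-monoˡ-≤ m m+N≤n)
  in trans (E-value m f n)
    (trans (cong₂ ℤ._-_ (trans (cong f (sym (m+[n∸m]≡n m≤n))) (per (n ∸ m) N≤n∸m)) (shift-∸ f m≤n))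
    (ℤP.+-inverseʳ (f (n ∸ m))))

periodic-* : ∀ k {N m f} → PeriodicFrom N m f → PeriodicFrom N (k * m) f
periodic-* zero    per n N≤n = refl
periodic-* (suc k) {N} {m} {f} per n N≤n = trans (cong f (+-assoc m (k * m) n))
  (trans (per (k * m + n) (≤-trans N≤n (m≤n+m n (k * m)))) (periodic-* k {f = f} per n N≤n))

periodic-diff : ∀ {N a b m f} → a ≡ m + b → PeriodicFrom N a f → PeriodicFrom N b f → PeriodicFrom N m f
periodic-diff {N} {a} {b} {m} {f} refl perᵃ perᵇ n N≤n =
  trans (sym (perᵇ (m + n) (≤-trans N≤n (m≤n+m n m))))
  (trans (cong f (trans (sym (+-assoc b m n)) (cong (_+ n) (+-comm b m)))) (perᵃ n N≤n))

-- Bézout gives multiples of ma and mb that differ by exactly m.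
periodic-coprime : ∀ {a b} m {f} → Coprime a b →
  UltimatelyPeriodic (m * a) f → UltimatelyPeriodic (m * b) f → UltimatelyPeriodic m f
periodic-coprime {a} {b} m {f} cop (K , perᵃ) (L , perᵇ) = K ⊔ L , main (coprime-Bézout cop)
  where
  perᵃ′ : PeriodicFrom (K ⊔ L) (m * a) f
  perᵃ′ n le = perᵃ n (m⊔n≤o⇒m≤o K L le)
  perᵇ′ : PeriodicFrom (K ⊔ L) (m * b) f
  perᵇ′ n le = perᵇ n (m⊔n≤o⇒n≤o K L le)
  scale : ∀ {x y a b} → 1 + y * b ≡ x * a → x * (m * a) ≡ m + y * (m * b)
  scale {x} {y} {a} {b} eq = trans (left x a) (trans (cong (m *_) (sym eq))
    (trans (*-distribˡ-+ m 1 (y * b)) (cong₂ _+_ (*-identityʳ m) (sym (left y b)))))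
    where
    left : ∀ x a → x * (m * a) ≡ m * (x * a)
    left x a = trans (sym (*-assoc x m a)) (trans (cong (_* a) (*-comm x m)) (*-assoc m x a))
  main : Bézout.Identity 1 a b → PeriodicFrom (K ⊔ L) m f
  main (Bézout.+- x y eq) = periodic-diff {f = f} (scale {x} {y} eq)
    (periodic-* x {f = f} perᵃ′) (periodic-* y {f = f} perᵇ′)
  main (Bézout.-+ x y eq) = periodic-diff {f = f} (scale {y} {x} eq)
    (periodic-* y {f = f} perᵇ′) (periodic-* x {f = f} perᵃ′)

periodic-1 : ∀ {f} a b → Coprime a b → UltimatelyPeriodic a f → UltimatelyPeriodic b f → UltimatelyPeriodic 1 f
periodic-1 {f} a b cop pa pb = periodic-coprime 1 cop
  (subst (λ k → UltimatelyPeriodic k f) (sym (*-identityˡ a)) pa)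
  (subst (λ k → UltimatelyPeriodic k f) (sym (*-identityˡ b)) pb)

-- The binary polynomial and the power series F

E-box : ∀ {p} q (f : Poly) → 1 ≤ p → E p (box q ⟨z^ p ⟩· f) ≗ E (p * q) f
E-box {p} q f 1≤p m = trans (cong (λ k → E k (box q ⟨z^ p ⟩· f) m) (sym (*-identityʳ p)))
  (trans (sym (act-Eˡ 1 (box q) f 1≤p m))
  (trans (act-cong p (E1-box q) (λ _ → refl) m)
  (trans (act-Eˡ q δ f 1≤p m) (E-cong (p * q) (act-δˡ p f) m))))

-- (1 - z^{pq}) / ((1 - z^p)(1 - z^q)), so that (1 - z) C is the binary polynomial Q_{p,q}.
C : ℕ → ℕ → Poly
C p q = box q ⟨z^ p ⟩· (ones ⟨z^ q ⟩· δ)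

Eq-C : ∀ {p q} → 1 ≤ p → 1 ≤ q → E q (C p q) ≗ box q ⟨z^ p ⟩· δ
Eq-C {p} {q} 1≤p 1≤q m = trans (sym (act-Eʳ q (box q) _ 1≤p m))
  (act-cong p (λ _ → refl) (E-geometric δ 1≤q) m)

C-equation : ∀ {p q} → 1 ≤ p → 1 ≤ q → E p (E q (C p q)) ≗ E (p * q) δ
C-equation {p} {q} 1≤p 1≤q m = trans (E-cong p (Eq-C 1≤p 1≤q) m) (E-box q δ 1≤p m)

C-comm : ∀ {p q} → 1 ≤ p → 1 ≤ q → C p q ≗ C q p
C-comm {p} {q} 1≤p 1≤q = E-injective q 1≤q (E-injective p 1≤p (λ m → trans (C-equation 1≤p 1≤q m)
  (trans (cong (λ k → E k δ m) (*-comm p q)) (trans (sym (C-equation 1≤q 1≤p m)) (E-comm q p (C q p) m)))))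

binary : ℕ → ℕ → Poly
binary p q = E 1 (C p q)

C-periodic : ∀ {p q} → 1 ≤ p → 1 ≤ q → UltimatelyPeriodic q (C p q)
C-periodic {p} {q} 1≤p 1≤q = E-vanishes⇒periodic q
  (vanishes-cong (Eq-C 1≤p 1≤q) (vanishes-act p (vanishes-box q) vanishes-δ))

-- C is a polynomial over 1 - z^q and, by symmetry, over 1 - z^p. Its coprime periods p and q make
-- it ultimately constant, which the factor 1 - z kills.
binary-vanishes : ∀ {p q} → 1 ≤ p → 1 ≤ q → Coprime p q → Vanishes (binary p q)
binary-vanishes {p} {q} 1≤p 1≤q cop = periodic⇒E-vanishes 1 (C p q) (periodic-1 p q cop
  (periodic-cong (C-comm 1≤p 1≤q) (C-periodic 1≤q 1≤p)) (C-periodic 1≤p 1≤q))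

-- Θ = (1 - z^p) / ((1 - z)(1 - z^{pq})). It is named separately because `F-vanishes` needs F with
-- the factor 1 - z^q taken out.
Θ χ : ℕ → ℕ → Poly
Θ p q = ones ⟨z^ p * q ⟩· box p
χ p q = E q (Θ p q)

Epq-Θ : ∀ {p q} → 1 ≤ p * q → E (p * q) (Θ p q) ≗ box p
Epq-Θ {p} 1≤pq = E-geometric (box p) 1≤pq

Epq-χ : ∀ {p q} → 1 ≤ p * q → E (p * q) (χ p q) ≗ E q (box p)
Epq-χ {p} {q} 1≤pq m = trans (E-comm (p * q) q (Θ p q) m) (E-cong q (Epq-Θ {p} {q} 1≤pq) m)

-- Q_{p,q,s} as a power series: Q_{p,q}(z^s) (1 - z^p)(1 - z^q) / ((1 - z)(1 - z^{pq})).
F : ℕ → ℕ → ℕ → Poly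
F p q s = binary p q ⟨z^ s ⟩· χ p q

module _ {p q s : ℕ} (1≤p : 1 ≤ p) (1≤q : 1 ≤ q) (1≤s : 1 ≤ s) where

  private
    1≤pq : 1 ≤ p * q
    1≤pq = *-mono-≤ 1≤p 1≤q

  binary-equation : E q (E p (binary p q)) ≗ E 1 (E (p * q) δ)
  binary-equation m = trans (Es-↭ {q ∷ p ∷ 1 ∷ []} (C p q) (↭-trans (PermP.shift 1 (q ∷ p ∷ []) []) (prep 1 (swap q p ↭-refl))) m)
    (E-cong 1 (C-equation 1≤p 1≤q) m)

  binary-act : ∀ f → E (s * q) (E (s * p) (binary p q ⟨z^ s ⟩· f)) ≗ E s (E (s * (p * q)) f)
  binary-act f m = trans (E-cong (s * q) (λ n → sym (act-Eˡ p (binary p q) f 1≤s n)) m)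
    (trans (sym (act-Eˡ q (E p (binary p q)) f 1≤s m))
    (trans (act-cong s binary-equation (λ _ → refl) m)
    (trans (act-Eˡ 1 (E (p * q) δ) f 1≤s m)
    (trans (cong (λ k → E k (E (p * q) δ ⟨z^ s ⟩· f) m) (*-identityʳ s))
    (E-cong s (λ n → trans (act-Eˡ (p * q) δ f 1≤s n) (E-cong (s * (p * q)) (act-δˡ s f) n)) m)))))

  F-equation : Es (p * q ∷ s * q ∷ s * p ∷ 1 ∷ []) (F p q s) ≗ Es (s ∷ q ∷ p ∷ s * (p * q) ∷ []) δ
  F-equation m = trans (Es-↭ (F p q s) outer m)
    (trans (Es-cong (p * q ∷ 1 ∷ []) (binary-act (χ p q)) m)
    (trans (Es-↭ (χ p q) inner m)
    (trans (Es-cong (s ∷ s * (p * q) ∷ []) χ-equation m)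
    (Es-↭ δ last m))))
    where
    outer : p * q ∷ s * q ∷ s * p ∷ 1 ∷ [] ↭ p * q ∷ 1 ∷ s * q ∷ s * p ∷ []
    outer = prep (p * q) (PermP.shift 1 (s * q ∷ s * p ∷ []) [])
    inner : p * q ∷ 1 ∷ s ∷ s * (p * q) ∷ [] ↭ s ∷ s * (p * q) ∷ 1 ∷ p * q ∷ []
    inner = ↭-trans (swap (p * q) 1 ↭-refl)
      (↭-trans (PermP.shift s (1 ∷ p * q ∷ []) (s * (p * q) ∷ []))
      (prep s (PermP.shift (s * (p * q)) (1 ∷ p * q ∷ []) [])))
    last : s ∷ s * (p * q) ∷ q ∷ p ∷ [] ↭ s ∷ q ∷ p ∷ s * (p * q) ∷ []
    last = prep s (↭-sym (PermP.shift (s * (p * q)) (q ∷ p ∷ []) []))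
    χ-equation : E 1 (E (p * q) (χ p q)) ≗ E q (E p δ)
    χ-equation n = trans (E-cong 1 (Epq-χ {p} {q} 1≤pq) n)
      (trans (E-comm 1 q (box p) n) (E-cong q (E1-box p) n))

  -- All factors on the left have exponent at least 1, hence can be cancelled. Any candidate for F
  -- is recognised by checking the cleared equation.
  F-unique : ∀ {f} → Es (p * q ∷ s * q ∷ s * p ∷ 1 ∷ []) f ≗ Es (s ∷ q ∷ p ∷ s * (p * q) ∷ []) δ → f ≗ F p q s
  F-unique h = Es-injective (1≤pq ∷ *-mono-≤ 1≤s 1≤q ∷ *-mono-≤ 1≤s 1≤p ∷ ≤-refl ∷ [])
    (λ m → trans (h m) (sym (F-equation m)))

F-rotate : ∀ {p q s} → 1 ≤ p → 1 ≤ q → 1 ≤ s → F q s p ≗ F p q s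
F-rotate {p} {q} {s} 1≤p 1≤q 1≤s = F-unique 1≤p 1≤q 1≤s (λ m →
  trans (Es-↭ (F q s p) (Perm.↭-reflexive (cong₂ (λ a b → p * q ∷ a ∷ b ∷ 1 ∷ []) (*-comm s q) (*-comm s p))) m)
  (trans (Es-↭ (F q s p) (↭-sym (PermP.shift (p * q) (q * s ∷ p * s ∷ []) (1 ∷ []))) m)
  (trans (F-equation 1≤q 1≤s 1≤p m)
  (trans (Es-↭ δ (↭-sym (PermP.shift p (s ∷ q ∷ []) (p * (q * s) ∷ []))) m)
  (Es-↭ δ (Perm.↭-reflexive (cong (λ a → s ∷ q ∷ p ∷ a ∷ []) product)) m)))))
  where
  product : p * (q * s) ≡ s * (p * q)
  product = trans (sym (*-assoc p q s)) (*-comm (p * q) s)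

F-swap : ∀ {p q s} → 1 ≤ p → 1 ≤ q → 1 ≤ s → F q p s ≗ F p q s
F-swap {p} {q} {s} 1≤p 1≤q 1≤s = F-unique 1≤p 1≤q 1≤s (λ m →
  trans (cong (λ k → Es (k ∷ s * q ∷ s * p ∷ 1 ∷ []) (F q p s) m) (*-comm p q))
  (trans (Es-↭ {q * p ∷ s * q ∷ s * p ∷ 1 ∷ []} (F q p s) (prep (q * p) (swap (s * q) (s * p) ↭-refl)) m)
  (trans (F-equation 1≤q 1≤p 1≤s m)
  (trans (Es-↭ {s ∷ p ∷ q ∷ s * (q * p) ∷ []} δ (prep s (swap p q ↭-refl)) m)
  (cong (λ k → Es (s ∷ q ∷ p ∷ s * k ∷ []) δ m) (*-comm q p))))))

cancel-pos : ∀ {n i} → 1 ≤ n → ℤ.+ n ℤ.* i ≡ 0ℤ → i ≡ 0ℤ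
cancel-pos {suc n} _ eq with ℤP.i*j≡0⇒i≡0∨j≡0 (ℤ.+ suc n) eq
... | inj₂ i≡0 = i≡0

-- Multiplying F by 1 - z^{pq} leaves the polynomial Q_{p,q}(z^s) (1 - z^q) `box p`. Rotating the
-- parameters yields the periods qs and sp.
F-periodic : ∀ {p q s} → 1 ≤ p → 1 ≤ q → 1 ≤ s → Coprime p q → UltimatelyPeriodic (p * q) (F p q s)
F-periodic {p} {q} {s} 1≤p 1≤q 1≤s cop = E-vanishes⇒periodic (p * q) (vanishes-cong
  (λ m → trans (sym (act-Eʳ (p * q) (binary p q) (χ p q) 1≤s m)) (act-cong s (λ _ → refl) (Epq-χ {p} {q} (*-mono-≤ 1≤p 1≤q)) m))
  (vanishes-act s (binary-vanishes 1≤p 1≤q cop) (vanishes-E q (vanishes-box p))))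

-- F is ultimately constant, with value κ; as F = (1 - z^q) W with W ultimately
-- pq-periodic, p steps of length q add pκ to W, whence κ = 0.
F-vanishes : ∀ {p q s} → 1 ≤ p → 1 ≤ q → 1 ≤ s →
  Coprime p q → Coprime q s → Coprime s p → Vanishes (F p q s)
F-vanishes {p} {q} {s} 1≤p 1≤q 1≤s cpq cqs csp = conclude constant W-periodic
  where
  period-pq : UltimatelyPeriodic (p * q) (F p q s)
  period-pq = F-periodic 1≤p 1≤q 1≤s cpq
  period-qs : UltimatelyPeriodic (q * s) (F p q s)
  period-qs = periodic-cong (λ m → sym (F-rotate 1≤p 1≤q 1≤s m)) (F-periodic 1≤q 1≤s 1≤p cqs)
  period-sp : UltimatelyPeriodic (s * p) (F p q s)
  period-sp = periodic-cong (F-rotate 1≤s 1≤p 1≤q) (F-periodic 1≤s 1≤p 1≤q csp)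
  recast : ∀ {a b} → a ≡ b → UltimatelyPeriodic a (F p q s) → UltimatelyPeriodic b (F p q s)
  recast eq = subst (λ k → UltimatelyPeriodic k (F p q s)) eq
  constant : UltimatelyPeriodic 1 (F p q s)
  -- The periods pq and ps give p, since q and s are coprime; qs and qp give q; and p and q give 1.
  constant = periodic-1 p q cpq
    (periodic-coprime p cqs period-pq (recast (*-comm s p) period-sp))
    (periodic-coprime q csp period-qs (recast (*-comm p q) period-pq))
  W : Poly
  W = binary p q ⟨z^ s ⟩· Θ p q
  F≗W : F p q s ≗ E q W
  F≗W = act-Eʳ q (binary p q) (Θ p q) 1≤s
  W-periodic : UltimatelyPeriodic (p * q) W
  W-periodic = E-vanishes⇒periodic (p * q) (vanishes-cong
    (λ m → trans (sym (act-Eʳ (p * q) (binary p q) (Θ p q) 1≤s m)) (act-cong s (λ _ → refl) (Epq-Θ {p} {q} (*-mono-≤ 1≤p 1≤q)) m))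
    (vanishes-act s (binary-vanishes 1≤p 1≤q cpq) (vanishes-box p)))
  conclude : UltimatelyPeriodic 1 (F p q s) → UltimatelyPeriodic (p * q) W → Vanishes (F p q s)
  conclude (K , perF) (L , perW) = K , vanish
    where
    module _ (N : ℕ) (K≤N : K ≤ N) (L≤N : L ≤ N) where
      κ = F p q s N
      F-const : ∀ j → F p q s (j + N) ≡ κ
      F-const j = trans (cong (λ k → F p q s (k + N)) (sym (*-identityʳ j))) (periodic-* j {f = F p q s} perF N K≤N)
      climb : ∀ j → W (j * q + N) ≡ ℤ.+ j ℤ.* κ ℤ.+ W N
      climb zero    = trans (sym (ℤP.+-identityˡ (W N))) (cong (λ x → x ℤ.+ W N) (sym (ℤP.*-zeroˡ κ)))
      climb (suc j) = trans (cong W (+-assoc q (j * q) N))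
        (trans (E-solve q W (q + (j * q + N)))
        (trans (cong₂ ℤ._+_ (trans (sym (F≗W _)) (trans (cong (F p q s) (sym (+-assoc q (j * q) N))) (F-const (q + j * q))))
                            (trans (shift-hit q W (j * q + N)) (climb j)))
        (trans (ring (ℤ.+ j) κ (W N)) (cong (λ x → x ℤ.* κ ℤ.+ W N) (sym (ℤP.pos-+ 1 j))))))
        where
        ring : ∀ j κ w → κ ℤ.+ (j ℤ.* κ ℤ.+ w) ≡ (1ℤ ℤ.+ j) ℤ.* κ ℤ.+ w
        ring = solve-∀
      pκ≡0 : ℤ.+ p ℤ.* κ ≡ 0ℤ
      pκ≡0 = ∙-cancelʳ (W N) _ _ (trans (sym (climb p)) (trans (perW N L≤N) (sym (ℤP.+-identityˡ (W N)))))
      κ≡0 : κ ≡ 0ℤ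
      κ≡0 = cancel-pos 1≤p pκ≡0
    vanish : ∀ n → K ≤ n → F p q s n ≡ 0ℤ
    -- Constancy moves n up to L + n, where the periodicity of W holds as well.
    vanish n K≤n = trans (sym (trans (cong (λ k → F p q s (k + n)) (sym (*-identityʳ L))) (periodic-* L {f = F p q s} perF n K≤n)))
      (κ≡0 (L + n) (≤-trans K≤n (m≤n+m n L)) (m≤m+n L n))

-- Q_{p,q} / (1 - z) and sums of consecutive coefficients of Q_{p,q}

sum-exclusive : ∀ (Φ : ℕ → Set) {g : Poly} L →
  (∀ i → g i ≡ 0ℤ ⊎ (g i ≡ 1ℤ × Φ i)) → (∀ {i j} → i < j → Φ i → Φ j → ⊥) →
  sumBelow L g ≡ 0ℤ ⊎ (sumBelow L g ≡ 1ℤ × ∃[ i ] (i < L × Φ i))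
sum-exclusive Φ zero    bit excl = inj₁ refl
sum-exclusive Φ (suc L) bit excl with bit L | sum-exclusive Φ L bit excl
... | inj₁ g≡0       | inj₁ s≡0                   = inj₁ (cong₂ ℤ._+_ s≡0 g≡0)
... | inj₁ g≡0       | inj₂ (s≡1 , i , i<L , Φi)  = inj₂ (cong₂ ℤ._+_ s≡1 g≡0 , i , m<n⇒m<1+n i<L , Φi)
... | inj₂ (g≡1 , Φ′) | inj₁ s≡0                  = inj₂ (cong₂ ℤ._+_ s≡0 g≡1 , L , ≤-refl , Φ′)
... | inj₂ (g≡1 , Φ′) | inj₂ (_ , i , i<L , Φi)   = ⊥-elim (excl i<L Φi Φ′)

multiples-bit : ∀ {q} → 1 ≤ q → ∀ n →
  (ones ⟨z^ q ⟩· δ) n ≡ 0ℤ ⊎ ((ones ⟨z^ q ⟩· δ) n ≡ 1ℤ × q ∣ n)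
multiples-bit {q} 1≤q n = below (suc n) n ≤-refl
  where
  G : Poly
  G = ones ⟨z^ q ⟩· δ
  unfold : ∀ i → G i ≡ δ i ℤ.+ shift q G i
  unfold i = trans (E-solve q G i) (cong (λ x → x ℤ.+ shift q G i) (E-geometric δ 1≤q i))
  below : ∀ k i → i < k → G i ≡ 0ℤ ⊎ (G i ≡ 1ℤ × q ∣ i)
  below (suc k) zero    _ = inj₂ (trans (unfold 0) (cong (λ x → 1ℤ ℤ.+ x) (shift-< G 1≤q)) , q ∣0)
  below (suc k) (suc i) (s≤s i<k) with q ≤? suc i
  ... | no  q≰ = inj₁ (trans (unfold (suc i)) (cong (λ x → 0ℤ ℤ.+ x) (shift-< G (≰⇒> q≰))))
  ... | yes q≤ with below k (suc i ∸ q) (<-≤-trans (∸-monoʳ-< {suc i} {q} {0} 1≤q q≤) i<k)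
  ...   | inj₁ eq       = inj₁ (trans (trans (unfold (suc i)) (trans (ℤP.+-identityˡ _) (shift-∸ G q≤))) eq)
  ...   | inj₂ (eq , d) = inj₂ (trans (trans (unfold (suc i)) (trans (ℤP.+-identityˡ _) (shift-∸ G q≤))) eq
                                , subst (q ∣_) (m+[n∸m]≡n q≤) (∣m∣n⇒∣m+n ∣-refl d))

-- n = p i + q b with b ≥ 0. The range i < q comes from the factor `box q` of C; the coefficient of
-- C at n counts such i.
Representation : ℕ → ℕ → ℕ → ℕ → Set
Representation p q n i = i < q × p * i ≤ n × q ∣ n ∸ p * i

-- Two representations give q ∣ p (j - i), hence q ∣ j - i, although 0 < j - i < q.
representation-unique : ∀ {p q n i j} → Coprime p q → i < j →
  Representation p q n i → Representation p q n j → ⊥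
representation-unique {p} {q} {n} {i} {j} cop i<j (_ , pi≤n , dᵢ) (j<q , pj≤n , dⱼ) =
  <⇒≱ (≤-<-trans (m∸n≤m j i) j<q)
    (∣⇒≤ {{>-nonZero (m<n⇒0<n∸m i<j)}} (coprime-divisor (Coprimality.sym cop)
      (∣m+n∣m⇒∣n (subst (q ∣_) split dᵢ) dⱼ)))
  where
  open ≡-Reasoning
  split : n ∸ p * i ≡ (n ∸ p * j) + p * (j ∸ i)
  split = begin
    n ∸ p * i                             ≡⟨ cong (_∸ p * i) (sym (m∸n+n≡m pj≤n)) ⟩
    (n ∸ p * j) + p * j ∸ p * i           ≡⟨ +-∸-assoc (n ∸ p * j) (*-monoʳ-≤ p (<⇒≤ i<j)) ⟩
    (n ∸ p * j) + (p * j ∸ p * i)         ≡⟨ cong ((n ∸ p * j) +_) (sym (*-distribˡ-∸ p j i)) ⟩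
    (n ∸ p * j) + p * (j ∸ i)             ∎

opaque
  unfolding _⟨z^_⟩·_

  C-bit : ∀ {p q} → 1 ≤ p → 1 ≤ q → Coprime p q → ∀ n →
    C p q n ≡ 0ℤ ⊎ (C p q n ≡ 1ℤ × ∃[ i ] Representation p q n i)
  C-bit {p} {q} 1≤p 1≤q cop n with sum-exclusive (Representation p q n) (suc n) term (representation-unique {n = n} cop)
    where
    term : ∀ i → box q i ℤ.* shift (p * i) (ones ⟨z^ q ⟩· δ) n ≡ 0ℤ
               ⊎ (box q i ℤ.* shift (p * i) (ones ⟨z^ q ⟩· δ) n ≡ 1ℤ × Representation p q n i)
    term i with i <? q
    ... | no i≮q = inj₁ (trans (cong (λ x → x ℤ.* shift (p * i) (ones ⟨z^ q ⟩· δ) n) (box-≥ (≮⇒≥ i≮q)))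
                     (ℤP.*-zeroˡ (shift (p * i) (ones ⟨z^ q ⟩· δ) n)))
    ... | yes i<q with p * i ≤? n
    ...   | no pi≰n = inj₁ (trans (cong (λ x → box q i ℤ.* x) (shift-< _ (≰⇒> pi≰n))) (ℤP.*-zeroʳ (box q i)))
    ...   | yes pi≤n with multiples-bit 1≤q (n ∸ p * i)
    ...     | inj₁ eq       = inj₁ (trans (cong (λ x → box q i ℤ.* x) (trans (shift-∸ _ pi≤n) eq)) (ℤP.*-zeroʳ (box q i)))
    ...     | inj₂ (eq , d) = inj₂ (cong₂ ℤ._*_ (box-< i<q) (trans (shift-∸ _ pi≤n) eq) , i<q , pi≤n , d)
  ... | inj₁ eq               = inj₁ eq
  ... | inj₂ (eq , i , _ , r) = inj₂ (eq , i , r)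

-- pq - p - q = p i + q b would mean p (i + 1) + q (b + 1) = pq. Then q ∣ i + 1, so p (i + 1) alone
-- is already at least pq.
C-frobenius : ∀ {p q n} → 1 ≤ p → 1 ≤ q → Coprime p q → n + (p + q) ≡ p * q → C p q n ≡ 0ℤ
C-frobenius {p} {q} {n} 1≤p 1≤q cop eq with C-bit 1≤p 1≤q cop n
... | inj₁ C≡0 = C≡0
... | inj₂ (_ , i , i<q , pi≤n , divides b n∸pi≡bq) = ⊥-elim (<-irrefl (sym total) (begin-strict
        p * q                     <⟨ m<m+n (p * q) (<-≤-trans 1≤q (m≤m+n q (b * q))) ⟩
        p * q + suc b * q         ≤⟨ +-monoˡ-≤ (suc b * q) (*-monoʳ-≤ p q≤1+i) ⟩
        p * suc i + suc b * q     ∎))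
  where
  total : p * suc i + suc b * q ≡ p * q
  total = let open ≡-Reasoning in begin
    p * suc i + suc b * q         ≡⟨ expand p q i b ⟩
    p * i + b * q + (p + q)       ≡⟨ cong (λ x → p * i + x + (p + q)) (sym n∸pi≡bq) ⟩
    p * i + (n ∸ p * i) + (p + q) ≡⟨ cong (_+ (p + q)) (m+[n∸m]≡n pi≤n) ⟩
    n + (p + q)                   ≡⟨ eq ⟩
    p * q                         ∎
    where
    expand : ∀ p q i b → p * suc i + suc b * q ≡ p * i + b * q + (p + q)
    expand = ℕSolver.solve-∀
  q≤1+i : q ≤ suc i
  q≤1+i = ∣⇒≤ (coprime-divisor (Coprimality.sym cop)
    (∣m+n∣m⇒∣n (subst (q ∣_) (trans (sym total) (+-comm (p * suc i) (suc b * q))) (n∣m*n p)) (n∣m*n (suc b))))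
  open ≤-Reasoning

Bit : ℤ → Set
Bit x = x ≡ 0ℤ ⊎ x ≡ 1ℤ

bit-difference : ∀ {x y} → Bit x → Bit y → ℤ.∣ x ℤ.- y ∣ ≤ 1
bit-difference (inj₁ refl) (inj₁ refl) = z≤n
bit-difference (inj₁ refl) (inj₂ refl) = s≤s z≤n
bit-difference (inj₂ refl) (inj₁ refl) = s≤s z≤n
bit-difference (inj₂ refl) (inj₂ refl) = z≤n

C-is-bit : ∀ {p q} → 1 ≤ p → 1 ≤ q → Coprime p q → ∀ n → Bit (C p q n)
C-is-bit 1≤p 1≤q cop n with C-bit 1≤p 1≤q cop n
... | inj₁ eq       = inj₁ eq
... | inj₂ (eq , _) = inj₂ eq

shift-bit : ∀ n {f} → (∀ i → Bit (f i)) → ∀ i → Bit (shift n f i)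
shift-bit zero    bit i       = bit i
shift-bit (suc n) bit zero    = inj₁ refl
shift-bit (suc n) bit (suc i) = shift-bit n bit i

-- b is the number of j < L with s j + u ≤ m.
Cut : (s u m L b : ℕ) → Set
Cut s u m L b = (∀ j → j < b → s * j + u ≤ m) × (b ≡ L ⊎ (b < L × m < s * b + u))

shift-ones : ∀ {a m} → a ≤ m → shift a ones m ≡ 1ℤ
shift-ones a≤m = shift-∸ ones a≤m

-- The coefficients of (1 - z) D telescope, and the weight is 1 up to the cut and 0 from there on.
-- `shift 1 D x` stands for D at x - 1, with value 0 at x = 0.
sum-cut : ∀ (D : Poly) a s u m L → ∃[ b ] (Cut s u m L b ×
  sumBelow L (λ j → E 1 D (a + j) ℤ.* shift (s * j + u) ones m) ≡ shift 1 D (a + b) ℤ.- shift 1 D a)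
sum-cut D a s u m zero = 0 , ((λ _ ()) , inj₁ refl) ,
  sym (trans (cong (λ k → shift 1 D k ℤ.- shift 1 D a) (+-identityʳ a)) (ℤP.+-inverseʳ (shift 1 D a)))
sum-cut D a s u m (suc L) with sum-cut D a s u m L
... | b , (low , inj₂ (b<L , m<)) , eq = b , (low , inj₂ (m<n⇒m<1+n b<L , m<)) ,
      trans (cong₂ ℤ._+_ eq (trans (cong (λ x → E 1 D (a + L) ℤ.* x)
        (shift-< ones (<-≤-trans m< (+-monoˡ-≤ u (*-monoʳ-≤ s (<⇒≤ b<L)))))) (ℤP.*-zeroʳ (E 1 D (a + L)))))
      (ℤP.+-identityʳ _)
... | b , (low , inj₁ refl) , eq with s * L + u ≤? m
...   | no  ≰m = b , (low , inj₂ (≤-refl , ≰⇒> ≰m)) ,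
      trans (cong₂ ℤ._+_ eq (trans (cong (λ x → E 1 D (a + L) ℤ.* x)
        (shift-< ones (≰⇒> ≰m))) (ℤP.*-zeroʳ (E 1 D (a + L)))))
      (ℤP.+-identityʳ _)
...   | yes ≤m = suc b , (below , inj₁ refl) ,
      trans (cong₂ ℤ._+_ eq (trans (cong (λ x → E 1 D (a + L) ℤ.* x) (shift-ones ≤m))
        (trans (ℤP.*-identityʳ _) (E-value 1 D (a + L)))))
      (trans (ring (shift 1 D (a + L)) (shift 1 D a) (D (a + L)))
      (cong (λ k → shift 1 D k ℤ.- shift 1 D a) (sym (+-suc a L))))
      where
      below : ∀ j → j < suc b → s * j + u ≤ m
      below j (s≤s j≤b) = ≤-trans (+-monoˡ-≤ u (*-monoʳ-≤ s j≤b)) ≤m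
      ring : ∀ x y d → (x ℤ.- y) ℤ.+ (d ℤ.- x) ≡ d ℤ.- y
      ring = solve-∀

-- A box is the difference of two step functions, so the sum is a difference of two cut sums; their
-- common start `shift 1 D a` cancels.
sum-window : ∀ (D : Poly) a s u v m L → ∃[ b ] ∃[ b′ ] (Cut s u m L b × Cut s (u + v) m L b′ ×
  sumBelow L (λ j → E 1 D (a + j) ℤ.* shift (s * j + u) (box v) m) ≡ shift 1 D (a + b) ℤ.- shift 1 D (a + b′))
sum-window D a s u v m L with sum-cut D a s u m L | sum-cut D a s (u + v) m L
... | b , cut , eq | b′ , cut′ , eq′ = b , b′ , cut , cut′ ,
  trans (sum-cong L (λ j _ → trans (cong (λ x → E 1 D (a + j) ℤ.* x) (weight j))
    (distrib (E 1 D (a + j)) (shift (s * j + u) ones m) (shift (s * j + (u + v)) ones m))))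
  (trans (sum-linear L 1ℤ -1ℤ _ _)
  (trans (cong₂ (λ x y → 1ℤ ℤ.* x ℤ.+ -1ℤ ℤ.* y) eq eq′)
  (ring (shift 1 D (a + b)) (shift 1 D (a + b′)) (shift 1 D a))))
  where
  weight : ∀ j → shift (s * j + u) (box v) m ≡ shift (s * j + u) ones m ℤ.- shift (s * j + (u + v)) ones m
  weight j = trans (shift-cong (s * j + u) (box-ones v) m)
    (trans (shift-binom (s * j + u) 1ℤ -1ℤ v ones m)
    (trans (E-value v (shift (s * j + u) ones) m)
    (cong (λ x → shift (s * j + u) ones m ℤ.- x)
      (trans (shift-comm v (s * j + u) ones m)
      (trans (shift-+ (s * j + u) v ones m) (cong (λ k → shift k ones m) (+-assoc (s * j) u v)))))))
  distrib : ∀ c x y → c ℤ.* (x ℤ.- y) ≡ 1ℤ ℤ.* (c ℤ.* x) ℤ.+ -1ℤ ℤ.* (c ℤ.* y)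
  distrib = solve-∀
  ring : ∀ x y d → 1ℤ ℤ.* (x ℤ.- d) ℤ.+ -1ℤ ℤ.* (y ℤ.- d) ≡ x ℤ.- y
  ring = solve-∀

-- Truncated coefficient sums

sum-neg : ∀ n {f g : Poly} → (∀ i → i < n → f i ≡ ℤ.- g i) → sumBelow n f ≡ ℤ.- sumBelow n g
sum-neg zero    h = refl
sum-neg (suc n) {f} {g} h = trans (cong₂ ℤ._+_ (sum-neg n (λ i i<n → h i (m<n⇒m<1+n i<n))) (h n ≤-refl))
  (sym (ℤP.neg-distrib-+ (sumBelow n g) (g n)))

shift-local : ∀ a {f g : Poly} t → (∀ x → x ≤ t → f x ≡ g x) → shift a f t ≡ shift a g t
shift-local zero    t       h = h t ≤-refl
shift-local (suc a) zero    h = refl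
shift-local (suc a) (suc t) h = shift-local a t (λ x x≤t → h x (m≤n⇒m≤1+n x≤t))

-- The coefficient sum of F at s k + t cut off after the k-th term, which loses nothing
-- when t < s. Unlike the full sum, it only depends on s and t modulo pq.
S : (p q s k t : ℕ) → ℤ
S p q s k t = sumBelow (suc k) (λ i → binary p q i ℤ.* shift (s * i) (χ p q) (s * k + t))

F≡S : ∀ {p q s k t} → t < s → F p q s (s * k + t) ≡ S p q s k t
F≡S {p} {q} {s} {k} {t} t<s = trans (sym (act-extend (binary p q) (χ p q) 1≤s (≤-refl {suc (s * k + t)})))
  (sum-extend (s≤s (≤-trans k≤sk (m≤m+n (s * k) t))) (λ i k<i →
    trans (cong (λ x → binary p q i ℤ.* x) (shift-< (χ p q) (beyond i k<i))) (ℤP.*-zeroʳ (binary p q i))))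
  where
  1≤s : 1 ≤ s
  1≤s = ≤-trans (s≤s z≤n) t<s
  k≤sk : k ≤ s * k
  k≤sk = ≤-trans (≤-reflexive (sym (*-identityˡ k))) (*-monoˡ-≤ k 1≤s)
  open ≤-Reasoning
  beyond : ∀ i → k < i → s * k + t < s * i
  beyond i k<i = begin-strict
    s * k + t   <⟨ +-monoʳ-< (s * k) t<s ⟩
    s * k + s   ≡⟨ +-comm (s * k) s ⟩
    s + s * k   ≡⟨ sym (*-suc s k) ⟩
    s * suc k   ≤⟨ *-monoʳ-≤ s k<i ⟩
    s * i       ∎

S-term : ∀ {s k i} t (f : Poly) → i ≤ k → shift (s * i) f (s * k + t) ≡ f (s * (k ∸ i) + t)
S-term {s} {k} {i} t f i≤k = trans (cong (shift (s * i) f) split) (shift-hit (s * i) f (s * (k ∸ i) + t))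
  where
  split : s * k + t ≡ s * i + (s * (k ∸ i) + t)
  split = trans (cong (λ x → s * x + t) (sym (m+[n∸m]≡n i≤k)))
    (trans (cong (_+ t) (*-distribˡ-+ s i (k ∸ i))) (+-assoc (s * i) (s * (k ∸ i)) t))

S-cong : ∀ {p q} s s′ k t t′ → (∀ d → χ p q (s * d + t) ≡ χ p q (s′ * d + t′)) → S p q s k t ≡ S p q s′ k t′
S-cong {p} {q} s s′ k t t′ h = sum-cong (suc k) λ { i (s≤s i≤k) →
  cong (λ x → binary p q i ℤ.* x) (trans (S-term {s} t (χ p q) i≤k)
    (trans (h (k ∸ i)) (sym (S-term {s′} t′ (χ p q) i≤k)))) }

S-neg : ∀ {p q} s s′ k t t′ → (∀ d → χ p q (s * d + t) ≡ ℤ.- χ p q (s′ * d + t′)) → S p q s k t ≡ ℤ.- S p q s′ k t′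
S-neg {p} {q} s s′ k t t′ h = sum-neg (suc k) λ { i (s≤s i≤k) →
  trans (cong (λ x → binary p q i ℤ.* x) (trans (S-term {s} t (χ p q) i≤k)
    (trans (h (k ∸ i)) (cong ℤ.-_ (sym (S-term {s′} t′ (χ p q) i≤k))))))
  (sym (ℤP.neg-distribʳ-* (binary p q i) _)) }

-- Periodicity and antisymmetry of χ; estimates of S for all t

module Residues {p q : ℕ} (1≤p : 1 ≤ p) (p<q : p < q) (p+q≤pq : p + q ≤ p * q) where

  1≤q : 1 ≤ q
  1≤q = ≤-trans 1≤p (<⇒≤ p<q)
  1≤pq : 1 ≤ p * q
  1≤pq = *-mono-≤ 1≤p 1≤q
  q≤pq : q ≤ p * q
  q≤pq = ≤-trans (m≤n+m q p) p+q≤pq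

  window-head : ∀ {x} → x < q → E q (box p) x ≡ box p x
  window-head {x} x<q = trans (E-value q (box p) x)
    (trans (cong (λ y → box p x ℤ.- y) (shift-< (box p) x<q)) (ℤP.+-identityʳ (box p x)))

  window-tail : ∀ {x} → q ≤ x → E q (box p) x ≡ ℤ.- box (p + q) x
  window-tail {x} q≤x = trans (E-value q (box p) x)
    (trans (cong₂ ℤ._-_ (box-≥ (≤-trans (<⇒≤ p<q) q≤x)) (shift-∸ (box p) q≤x))
    (trans (ℤP.+-identityˡ (ℤ.- box p (x ∸ q))) (cong ℤ.-_ moved)))
    where
    moved : box p (x ∸ q) ≡ box (p + q) x
    moved with x <? p + q
    ... | yes x< = trans (box-< (subst (x ∸ q <_) (m+n∸n≡m p q) (∸-monoˡ-< x< q≤x))) (sym (box-< x<))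
    ... | no  x≮ = trans (box-≥ (subst (_≤ x ∸ q) (m+n∸n≡m p q) (∸-monoˡ-≤ q (≮⇒≥ x≮)))) (sym (box-≥ (≮⇒≥ x≮)))

  window-≥ : ∀ {x} → p + q ≤ x → E q (box p) x ≡ 0ℤ
  window-≥ p+q≤x = trans (window-tail (≤-trans (m≤n+m q p) p+q≤x)) (cong ℤ.-_ (box-≥ p+q≤x))

  -- The window is +1 on [0, p), 0 on [p, q) and -1 on [q, p + q). The reflection exchanges the two
  -- outer blocks, which have equal length.
  window-antisym : ∀ x y → suc (x + y) ≡ p + q → E q (box p) x ≡ ℤ.- E q (box p) y
  window-antisym x y eq with q ≤? x | q ≤? y
  ... | yes q≤x | _ = trans (window-tail q≤x) (trans (cong ℤ.-_ (box-< x<p+q)) (cong ℤ.-_ (sym (trans (window-head (<-trans y<p p<q)) (box-< y<p)))))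
    where
    x<p+q : x < p + q
    x<p+q = subst (x <_) eq (s≤s (m≤m+n x y))
    y<p : y < p
    y<p = +-cancelʳ-≤ q (suc y) p (subst (suc y + q ≤_) (trans (cong suc (+-comm y x)) eq) (+-monoʳ-≤ (suc y) q≤x))
  ... | no q≰x | yes q≤y = trans (window-head (≰⇒> q≰x)) (trans (box-< x<p) (cong ℤ.-_ (sym (trans (window-tail q≤y) (cong ℤ.-_ (box-< y<p+q))))))
    where
    y<p+q : y < p + q
    y<p+q = subst (y <_) eq (s≤s (m≤n+m y x))
    x<p : x < p
    x<p = +-cancelʳ-≤ q (suc x) p (subst (suc x + q ≤_) eq (+-monoʳ-≤ (suc x) q≤y))
  ... | no q≰x | no q≰y = trans (trans (window-head (≰⇒> q≰x)) (box-≥ p≤x))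
      (cong ℤ.-_ (sym (trans (window-head (≰⇒> q≰y)) (box-≥ p≤y))))
    where
    p≤x : p ≤ x
    p≤x = +-cancelʳ-≤ q p x (subst (_≤ x + q) (trans (+-suc x y) eq) (+-monoʳ-≤ x (≰⇒> q≰y)))
    p≤y : p ≤ y
    p≤y = +-cancelʳ-≤ q p y (subst (_≤ y + q) (trans (+-suc y x) (trans (cong suc (+-comm y x)) eq)) (+-monoʳ-≤ y (≰⇒> q≰x)))

  χ-solve : ∀ x → χ p q x ≡ E q (box p) x ℤ.+ shift (p * q) (χ p q) x
  χ-solve x = trans (E-solve (p * q) (χ p q) x)
    (cong (λ y → y ℤ.+ shift (p * q) (χ p q) x) (Epq-χ {p} {q} 1≤pq x))

  χ-small : ∀ {x} → x < p * q → χ p q x ≡ E q (box p) x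
  χ-small {x} x<pq = trans (χ-solve x)
    (trans (cong (λ y → E q (box p) x ℤ.+ y) (shift-< (χ p q) x<pq)) (ℤP.+-identityʳ (E q (box p) x)))

  χ-period : ∀ x → χ p q (p * q + x) ≡ χ p q x
  χ-period x = trans (χ-solve (p * q + x))
    (trans (cong₂ ℤ._+_ (window-≥ (≤-trans p+q≤pq (m≤m+n (p * q) x))) (shift-hit (p * q) (χ p q) x))
    (ℤP.+-identityˡ (χ p q x)))

  χ-period* : ∀ m x → χ p q (m * (p * q) + x) ≡ χ p q x
  χ-period* m x = periodic-* m {0} {p * q} {χ p q} (λ n _ → χ-period n) x z≤n

  -- Induction on m removes a period from x or y if one of them is at least pq. If neither is, the
  -- sum forces both to be at least p + q, where the first period of χ is 0.
  χ-antisym : ∀ m x y → suc (x + y) ≡ (p + q) + m * (p * q) → χ p q x ≡ ℤ.- χ p q y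
  χ-antisym zero x y eq = trans (χ-small (small (s≤s (m≤m+n x y))))
    (trans (window-antisym x y eq′) (cong ℤ.-_ (sym (χ-small (small (s≤s (m≤n+m y x)))))))
    where
    eq′ : suc (x + y) ≡ p + q
    eq′ = trans eq (+-identityʳ (p + q))
    small : ∀ {z} → z < suc (x + y) → z < p * q
    small z< = ≤-trans z< (≤-trans (≤-reflexive eq′) p+q≤pq)
  χ-antisym (suc m) x y eq with p * q ≤? x | p * q ≤? y
  ... | yes pq≤x | _ = trans (cong (χ p q) (sym (m+[n∸m]≡n pq≤x))) (trans (χ-period (x ∸ p * q))
        (χ-antisym m (x ∸ p * q) y (+-cancelˡ-≡ (p * q) _ _ (trans moved (trans eq (rearrange (p + q) (p * q) (m * (p * q))))))))
    where
    rearrange : ∀ a b c → a + (b + c) ≡ b + (a + c)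
    rearrange = ℕSolver.solve-∀
    moved : p * q + suc (x ∸ p * q + y) ≡ suc (x + y)
    moved = trans (+-suc (p * q) (x ∸ p * q + y))
      (cong suc (trans (sym (+-assoc (p * q) (x ∸ p * q) y)) (cong (_+ y) (m+[n∸m]≡n pq≤x))))
  ... | no _ | yes pq≤y = trans (χ-antisym m x (y ∸ p * q) (+-cancelˡ-≡ (p * q) _ _ (trans moved (trans eq (rearrange (p + q) (p * q) (m * (p * q)))))))
        (cong ℤ.-_ (trans (sym (χ-period (y ∸ p * q))) (cong (χ p q) (m+[n∸m]≡n pq≤y))))
    where
    rearrange : ∀ a b c → a + (b + c) ≡ b + (a + c)
    rearrange = ℕSolver.solve-∀
    swapped : ∀ a x y → a + suc (x + y) ≡ suc (x + (a + y))
    swapped = ℕSolver.solve-∀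
    moved : p * q + suc (x + (y ∸ p * q)) ≡ suc (x + y)
    moved = trans (swapped (p * q) x (y ∸ p * q)) (cong (λ z → suc (x + z)) (m+[n∸m]≡n pq≤y))
  ... | no pq≰x | no pq≰y = trans (trans (χ-small (≰⇒> pq≰x)) (window-≥ (large x y (≰⇒> pq≰y) eq)))
      (cong ℤ.-_ (sym (trans (χ-small (≰⇒> pq≰y)) (window-≥ (large y x (≰⇒> pq≰x) (trans (cong suc (+-comm y x)) eq))))))
    where
    large : ∀ x y → y < p * q → suc (x + y) ≡ (p + q) + suc m * (p * q) → p + q ≤ x
    large x y y<pq eq = +-cancelʳ-≤ (p * q) (p + q) x (≤-trans
      (+-monoʳ-≤ (p + q) (m≤m+n (p * q) (m * (p * q))))
      (≤-trans (≤-reflexive (trans (sym eq) (sym (+-suc x y)))) (+-monoʳ-≤ x y<pq)))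

  S-mod : ∀ {r s m k t} → r ≡ s + m * (p * q) → S p q r k t ≡ S p q s k t
  S-mod {r} {s} {m} {k} {t} refl = S-cong {p} {q} (s + m * (p * q)) s k t t (λ d → trans (cong (χ p q) (rearrange s m (p * q) d t)) (χ-period* (m * d) (s * d + t)))
    where
    rearrange : ∀ s m b d t → (s + m * b) * d + t ≡ m * d * b + (s * d + t)
    rearrange = ℕSolver.solve-∀

  S-period : ∀ {s k t} m → S p q s k (t + m * (p * q)) ≡ S p q s k t
  S-period {s} {k} {t} m = S-cong {p} {q} s s k (t + m * (p * q)) t (λ d → trans (cong (χ p q) (rearrange (s * d) t (m * (p * q)))) (χ-period* m (s * d + t)))
    where
    rearrange : ∀ a t b → a + (t + b) ≡ b + (a + t)
    rearrange = ℕSolver.solve-∀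

  -- As r + s ≡ 0 modulo pq, the arguments r d + t and s d + t′ add up to p + q - 1 modulo pq for
  -- every d, so all terms change sign together.
  S-reflect : ∀ {r s m k t t′} j → r + s ≡ m * (p * q) → suc (t + t′) ≡ (p + q) + j * (p * q) →
    S p q r k t ≡ ℤ.- S p q s k t′
  S-reflect {r} {s} {m} {k} {t} {t′} j eq eq′ =
    S-neg {p} {q} r s k t t′ (λ d → χ-antisym (j + d * m) (r * d + t) (s * d + t′) (total d))
    where
    rearrange : ∀ r s d t t′ → suc (r * d + t + (s * d + t′)) ≡ suc (t + t′) + d * (r + s)
    rearrange = ℕSolver.solve-∀
    collect : ∀ a j b d m → a + j * b + d * (m * b) ≡ a + (j + d * m) * b
    collect = ℕSolver.solve-∀
    total : ∀ d → suc (r * d + t + (s * d + t′)) ≡ (p + q) + (j + d * m) * (p * q)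
    total d = trans (rearrange r s d t t′) (trans (cong₂ _+_ eq′ (cong (d *_) eq)) (collect (p + q) j (p * q) d m))

  -- `low-error` collects the terms after the k-th of the full coefficient sum, where only values of
  -- χ below q enter and χ is `box p`. `high-error` is the cost of replacing χ at x by χ at x - pq.
  -- The forms `0 + j` and `s * j + 0` match `sum-window`.
  low-error high-error : (s k t : ℕ) → ℤ
  low-error s k t = sumBelow (s * k + t) (λ j → binary p q (suc k + j) ℤ.* shift (s * j + s) (box p) t)
  high-error s k t = sumBelow (suc k) (λ j → binary p q (0 + j) ℤ.* shift (s * j + 0) (box (p + q)) (s * k + t))

  S-low : ∀ {s k t} → 1 ≤ s → t < q → S p q s k t ≡ F p q s (s * k + t) ℤ.- low-error s k t
  S-low {s} {k} {t} 1≤s t<q = trans (cancel (S p q s k t) (low-error s k t)) (cong (λ x → x ℤ.- low-error s k t) (sym F-split))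
    where
    cancel : ∀ x y → x ≡ (x ℤ.+ y) ℤ.- y
    cancel = solve-∀
    index : ∀ s k j → s * (suc k + j) ≡ s * k + (s * j + s)
    index = ℕSolver.solve-∀
    F-split : F p q s (s * k + t) ≡ S p q s k t ℤ.+ low-error s k t
    F-split = trans (sym (act-extend (binary p q) (χ p q) 1≤s (s≤s (m≤n+m (s * k + t) k))))
      (trans (sum-++ (suc k) (s * k + t) _)
      (cong (λ x → S p q s k t ℤ.+ x) (sum-cong (s * k + t) (λ j _ → cong (λ x → binary p q (suc k + j) ℤ.* x)
        (trans (cong (λ a → shift a (χ p q) (s * k + t)) (index s k j))
        (trans (shift-cancel (s * k) (s * j + s) (χ p q) t)
        (shift-local (s * j + s) t (λ x x≤t → let x<q = ≤-<-trans x≤t t<q in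
          trans (χ-small (<-≤-trans x<q q≤pq)) (window-head x<q)))))))))

  -- Every argument of χ in S is at least t ≥ q, where χ differs from its translate by pq only by
  -- -`box (p + q)`. For the translate nothing is lost by the truncation, because t < pq.
  S-high : ∀ {s k t} → 1 ≤ s → q ≤ t → t < p * q →
    S p q s k t ≡ shift (p * q) (F p q s) (s * k + t) ℤ.- high-error s k t
  S-high {s} {k} {t} 1≤s q≤t t<pq = trans
    (sum-cong (suc k) λ { i (s≤s i≤k) → trans (cong (λ x → binary p q i ℤ.* x) (term i i≤k))
      (distrib (binary p q i) _ _) })
    (trans (sum-linear (suc k) 1ℤ -1ℤ _ _)
    (trans (cong (λ x → 1ℤ ℤ.* x ℤ.+ -1ℤ ℤ.* high-error s k t) previous)
    (ring (shift (p * q) (F p q s) (s * k + t)) (high-error s k t))))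
    where
    distrib : ∀ c x y → c ℤ.* (x ℤ.- y) ≡ 1ℤ ℤ.* (c ℤ.* x) ℤ.+ -1ℤ ℤ.* (c ℤ.* y)
    distrib = solve-∀
    ring : ∀ x y → 1ℤ ℤ.* x ℤ.+ -1ℤ ℤ.* y ≡ x ℤ.- y
    ring = solve-∀
    term : ∀ i → i ≤ k → shift (s * i) (χ p q) (s * k + t) ≡
      shift (s * i) (shift (p * q) (χ p q)) (s * k + t) ℤ.- shift (s * i + 0) (box (p + q)) (s * k + t)
    term i i≤k = trans (S-term {s} t (χ p q) i≤k)
      (trans (χ-solve x)
      (trans (cong (λ y → y ℤ.+ shift (p * q) (χ p q) x) (window-tail (≤-trans q≤t (m≤n+m t (s * (k ∸ i))))))
      (trans (ℤP.+-comm (ℤ.- box (p + q) x) (shift (p * q) (χ p q) x))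
      (cong₂ ℤ._-_ (sym (S-term {s} t (shift (p * q) (χ p q)) i≤k))
        (sym (trans (cong (λ a → shift a (box (p + q)) (s * k + t)) (+-identityʳ (s * i))) (S-term {s} t (box (p + q)) i≤k)))))))
      where
      x : ℕ
      x = s * (k ∸ i) + t
    k≤sk : k ≤ s * k
    k≤sk = ≤-trans (≤-reflexive (sym (*-identityˡ k))) (*-monoˡ-≤ k 1≤s)
    beyond : ∀ i → k < i → s * k + t < s * i + p * q
    beyond i k<i = +-mono-≤-< (*-monoʳ-≤ s (<⇒≤ k<i)) t<pq
    previous : sumBelow (suc k) (λ i → binary p q i ℤ.* shift (s * i) (shift (p * q) (χ p q)) (s * k + t))
      ≡ shift (p * q) (F p q s) (s * k + t)
    previous = sym (trans (shift-act (p * q) (binary p q) (χ p q) 1≤s (s * k + t))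
      (trans (sym (act-extend (binary p q) (shift (p * q) (χ p q)) 1≤s (≤-refl {suc (s * k + t)})))
      (sum-extend (s≤s (≤-trans k≤sk (m≤m+n (s * k) t))) (λ i k<i →
        trans (cong (λ x → binary p q i ℤ.* x) (trans (shift-+ (s * i) (p * q) (χ p q) (s * k + t)) (shift-< (χ p q) (beyond i k<i))))
          (ℤP.*-zeroʳ (binary p q i))))))

  module _ (cop : Coprime p q) where

    C-bits : ∀ n → Bit (C p q n)
    C-bits = C-is-bit 1≤p 1≤q cop

    window-sum≤1 : ∀ a s u v m L →
      ℤ.∣ sumBelow L (λ j → binary p q (a + j) ℤ.* shift (s * j + u) (box v) m) ∣ ≤ 1
    window-sum≤1 a s u v m L with sum-window (C p q) a s u v m L
    ... | b , b′ , _ , _ , eq = subst (λ x → ℤ.∣ x ∣ ≤ 1) (sym eq)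
            (bit-difference (shift-bit 1 C-bits (a + b)) (shift-bit 1 C-bits (a + b′)))

    binary≤1 : ∀ n → ℤ.∣ binary p q n ∣ ≤ 1
    binary≤1 n = subst (λ x → ℤ.∣ x ∣ ≤ 1) (sym (E-value 1 (C p q) n)) (bit-difference (C-bits n) (shift-bit 1 C-bits n))

    reduce : ∀ {s k b} → (∀ t → t < p * q → ℤ.∣ S p q s k t ∣ ≤ b) → ∀ t → ℤ.∣ S p q s k t ∣ ≤ b
    reduce {s} {k} {b} h t = subst (λ x → ℤ.∣ x ∣ ≤ b)
      (trans (sym (S-period {s} {k} (t / (p * q)))) (cong (S p q s k) (sym (m≡m%n+[m/n]*n t (p * q)))))
      (h (t % (p * q)) (m%n<n t (p * q)))
      where instance _ = >-nonZero 1≤pq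

    S-bound : ∀ {s b} k t → 1 ≤ s → (∀ n → ℤ.∣ F p q s n ∣ ≤ b) → ℤ.∣ S p q s k t ∣ ≤ b + 1
    S-bound {s} {b} k t 1≤s bound = reduce {s} {k} main t
      where
      close : ∀ {e w} → ℤ.∣ e ∣ ≤ b → ℤ.∣ w ∣ ≤ 1 → ℤ.∣ e ℤ.- w ∣ ≤ b + 1
      close {e} {w} e≤b w≤1 = ≤-trans (ℤP.∣i-j∣≤∣i∣+∣j∣ e w) (+-mono-≤ e≤b w≤1)
      shifted : ∀ a n → ℤ.∣ shift a (F p q s) n ∣ ≤ b
      shifted a n with a ≤? n
      ... | yes a≤n = subst (λ x → ℤ.∣ x ∣ ≤ b) (sym (shift-∸ (F p q s) a≤n)) (bound (n ∸ a))
      ... | no  a≰n = subst (λ x → ℤ.∣ x ∣ ≤ b) (sym (shift-< (F p q s) (≰⇒> a≰n))) z≤n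
      main : ∀ t → t < p * q → ℤ.∣ S p q s k t ∣ ≤ b + 1
      main t t<pq with q ≤? t
      ... | no  q≰t = subst (λ x → ℤ.∣ x ∣ ≤ b + 1) (sym (S-low 1≤s (≰⇒> q≰t)))
              (close {F p q s (s * k + t)} {low-error s k t} (bound (s * k + t)) (window-sum≤1 (suc k) s s p t (s * k + t)))
      ... | yes q≤t = subst (λ x → ℤ.∣ x ∣ ≤ b + 1) (sym (S-high 1≤s q≤t t<pq))
              (close {shift (p * q) (F p q s) (s * k + t)} {high-error s k t} (shifted (p * q) (s * k + t)) (window-sum≤1 0 s 0 (p + q) (s * k + t) (suc k)))

    F1≗δ : F p q 1 ≗ δ
    F1≗δ m = sym (F-unique 1≤p 1≤q (≤-refl {1}) (λ n → trans (Es-↭ δ left n) (Es-↭ δ right n)) m)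
      where
      left : p * q ∷ 1 * q ∷ 1 * p ∷ 1 ∷ [] ↭ 1 ∷ p * q ∷ q ∷ p ∷ []
      left = ↭-trans (Perm.↭-reflexive (cong₂ (λ a b → p * q ∷ a ∷ b ∷ 1 ∷ []) (*-identityˡ q) (*-identityˡ p)))
        (PermP.shift 1 (p * q ∷ q ∷ p ∷ []) [])
      right : 1 ∷ p * q ∷ q ∷ p ∷ [] ↭ 1 ∷ q ∷ p ∷ 1 * (p * q) ∷ []
      right = ↭-trans (prep 1 (↭-sym (PermP.shift (p * q) (q ∷ p ∷ []) [])))
        (Perm.↭-reflexive (cong (λ a → 1 ∷ q ∷ p ∷ a ∷ []) (sym (*-identityˡ (p * q)))))

    -- By C-frobenius the correction -1 does not occur at n = pq, where δ contributes 1.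
    high-error-bit : ∀ {k t} → 1 * k + t ≡ p * q → Bit (high-error 1 k t)
    high-error-bit {k} {t} n≡pq with sum-window (C p q) 0 1 0 (p + q) (1 * k + t) (suc k)
    ... | b , zero , _ , _ , eq = subst Bit (sym (trans eq (ℤP.+-identityʳ _))) (shift-bit 1 C-bits b)
    -- The second cut lies strictly inside: x + p + q ≤ pq < x + 1 + p + q pins x to the Frobenius
    -- number.
    ... | b , suc x , _ , (low , inj₂ (_ , n<)) , eq =
            subst Bit (sym (trans eq (trans (cong (λ y → shift 1 (C p q) b ℤ.- y) (C-frobenius 1≤p 1≤q cop x+p+q≡pq)) (ℤP.+-identityʳ _))))
              (shift-bit 1 C-bits b)
      where
      x+p+q≡pq : x + (p + q) ≡ p * q
      x+p+q≡pq = ≤-antisym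
        (subst₂ _≤_ (cong (_+ (p + q)) (*-identityˡ x)) n≡pq (low x ≤-refl))
        (s≤s⁻¹ (subst₂ _<_ n≡pq (cong (_+ (p + q)) (*-identityˡ (suc x))) n<))
    -- Neither sum is cut, so the two ends coincide.
    ... | b , suc x , (_ , inj₁ refl) , (_ , inj₁ refl) , eq =
            inj₁ (trans eq (ℤP.+-inverseʳ (shift 1 (C p q) (suc k))))
    -- Impossible: the sum with the larger offset cannot be cut later than the other.
    ... | b , suc x , (_ , inj₂ (b<1+k , n<)) , (low , inj₁ refl) , eq =
            ⊥-elim (<-irrefl refl (<-≤-trans n< (≤-trans (+-monoʳ-≤ (1 * b) z≤n) (low b b<1+k))))

    -- `S-bound` would only give 2 here. The improvement comes from δ being nonzero at a single
    -- index, where the error term is under control.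
    S-bound-1 : ∀ k t → ℤ.∣ S p q 1 k t ∣ ≤ 1
    S-bound-1 k = reduce {1} {k} main
      where
      low : ∀ n {f x} → x ≡ δ n ℤ.- sumBelow n f → ℤ.∣ sumBelow n f ∣ ≤ 1 → ℤ.∣ x ∣ ≤ 1
      -- At index 0, where δ is 1, the error sum is empty.
      low zero    refl _ = ≤-refl
      low (suc n) {f} refl h = subst (_≤ 1) (trans (sym (ℤP.∣-i∣≡∣i∣ (sumBelow (suc n) f))) (cong ℤ.∣_∣ (sym (ℤP.+-identityˡ (ℤ.- sumBelow (suc n) f))))) h
      one-minus-bit : ∀ {w} → Bit w → ℤ.∣ 1ℤ ℤ.- w ∣ ≤ 1
      one-minus-bit = bit-difference (inj₂ refl)
      high : ∀ a n {w} → ℤ.∣ w ∣ ≤ 1 → (n ≡ a → Bit w) → ℤ.∣ shift a δ n ℤ.- w ∣ ≤ 1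
      high zero    zero    h bit = one-minus-bit (bit refl)
      high zero    (suc n) {w} h bit = subst (_≤ 1) (trans (sym (ℤP.∣-i∣≡∣i∣ w)) (cong ℤ.∣_∣ (sym (ℤP.+-identityˡ (ℤ.- w))))) h
      high (suc a) zero    {w} h bit = subst (_≤ 1) (trans (sym (ℤP.∣-i∣≡∣i∣ w)) (cong ℤ.∣_∣ (sym (ℤP.+-identityˡ (ℤ.- w))))) h
      high (suc a) (suc n) h bit = high a n h (λ eq → bit (cong suc eq))
      main : ∀ t → t < p * q → ℤ.∣ S p q 1 k t ∣ ≤ 1
      main t t<pq with q ≤? t
      ... | no  q≰t = low (1 * k + t)
              (trans (S-low (≤-refl {1}) (≰⇒> q≰t)) (cong (λ x → x ℤ.- low-error 1 k t) (F1≗δ (1 * k + t))))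
              (window-sum≤1 (suc k) 1 1 p t (1 * k + t))
      ... | yes q≤t = subst (λ x → ℤ.∣ x ∣ ≤ 1)
              (sym (trans (S-high (≤-refl {1}) q≤t t<pq) (cong (λ x → x ℤ.- high-error 1 k t) (shift-cong (p * q) F1≗δ (1 * k + t)))))
              (high (p * q) (1 * k + t) (window-sum≤1 0 1 0 (p + q) (1 * k + t) (suc k)) (high-error-bit {k} {t}))

-- The case s = 2

sgn : ℕ → ℤ
sgn zero    = 1ℤ
sgn (suc n) = ℤ.- sgn n

sgn-+ : ∀ m n → sgn (m + n) ≡ sgn m ℤ.* sgn n
sgn-+ zero    n = sym (ℤP.*-identityˡ (sgn n))
sgn-+ (suc m) n = trans (cong ℤ.-_ (sgn-+ m n)) (ℤP.neg-distribˡ-* (sgn m) (sgn n))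

sgn-* : ∀ m n → sgn n ≡ -1ℤ → sgn (m * n) ≡ sgn m
sgn-* zero    n odd = refl
sgn-* (suc m) n odd = trans (sgn-+ n (m * n))
  (trans (cong₂ ℤ._*_ odd (sgn-* m n odd)) (ℤP.-1*i≡-i (sgn m)))

∣sgn∣ : ∀ n → ℤ.∣ sgn n ∣ ≡ 1
∣sgn∣ zero    = refl
∣sgn∣ (suc n) = trans (ℤP.∣-i∣≡∣i∣ (sgn n)) (∣sgn∣ n)

sgn-odd : ∀ n → 2 ∣ n ⊎ sgn n ≡ -1ℤ
sgn-odd zero          = inj₁ (2 ∣0)
sgn-odd (suc zero)    = inj₂ refl
sgn-odd (suc (suc n)) with sgn-odd n
... | inj₁ 2∣n = inj₁ (∣m∣n⇒∣m+n ∣-refl 2∣n)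
... | inj₂ eq  = inj₂ (trans (ℤP.neg-involutive (sgn n)) eq)

coprime-2⇒sgn : ∀ {n} → Coprime 2 n → sgn n ≡ -1ℤ
coprime-2⇒sgn {n} cop with sgn-odd n
... | inj₂ eq  = eq
... | inj₁ 2∣n with cop (∣-refl , 2∣n)
...   | ()

-- The substitution z ↦ -z.
alternate : Poly → Poly
alternate f n = sgn n ℤ.* f n

shift-alternate : ∀ a (f : Poly) n → shift a (alternate f) n ≡ sgn a ℤ.* (sgn n ℤ.* shift a f n)
shift-alternate zero    f n       = sym (ℤP.*-identityˡ (alternate f n))
shift-alternate (suc a) f zero    = sym (ℤP.*-zeroʳ (sgn (suc a)))
shift-alternate (suc a) f (suc n) = trans (shift-alternate a f n) (ring (sgn a) (sgn n) (shift a f n))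
  where
  ring : ∀ a n x → a ℤ.* (n ℤ.* x) ≡ ℤ.- a ℤ.* (ℤ.- n ℤ.* x)
  ring = solve-∀

opaque
  unfolding binom

  -- For odd a, replacing z by -z turns 1 - z^a into 1 + z^a.
  alternate-E : ∀ {a} (f : Poly) → sgn a ≡ -1ℤ → alternate (E a f) ≗ P a (alternate f)
  alternate-E {a} f odd n = trans (ring (sgn n) (f n) (shift a f n))
    (cong (λ x → 1ℤ ℤ.* alternate f n ℤ.+ 1ℤ ℤ.* x)
      (sym (trans (shift-alternate a f n) (cong (λ x → x ℤ.* (sgn n ℤ.* shift a f n)) odd))))
    where
    ring : ∀ n x y → n ℤ.* (1ℤ ℤ.* x ℤ.+ -1ℤ ℤ.* y) ≡ 1ℤ ℤ.* (n ℤ.* x) ℤ.+ 1ℤ ℤ.* (-1ℤ ℤ.* (n ℤ.* y))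
    ring = solve-∀

  E-P : ∀ a (f : Poly) → E a (P a f) ≗ E (2 * a) f
  E-P a f m = trans (cong (λ x → 1ℤ ℤ.* P a f m ℤ.+ -1ℤ ℤ.* x) (shift-linear a 1ℤ 1ℤ f (shift a f) m))
    (trans (ring (f m) (shift a f m) (shift a (shift a f) m))
    (cong (λ x → 1ℤ ℤ.* f m ℤ.+ -1ℤ ℤ.* x) (trans (shift-+ a a f m)
      (cong (λ k → shift (a + k) f m) (sym (+-identityʳ a))))))
    where
    ring : ∀ x y z → 1ℤ ℤ.* (1ℤ ℤ.* x ℤ.+ 1ℤ ℤ.* y) ℤ.+ -1ℤ ℤ.* (1ℤ ℤ.* y ℤ.+ 1ℤ ℤ.* z) ≡ 1ℤ ℤ.* x ℤ.+ -1ℤ ℤ.* z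
    ring = solve-∀

  M-M : ∀ a b (f : Poly) → M a (M b f) ≗ E a (E b f)
  M-M a b f m = trans (cong (λ x → -1ℤ ℤ.* M b f m ℤ.+ 1ℤ ℤ.* x) (shift-linear a -1ℤ 1ℤ f (shift b f) m))
    (trans (ring (f m) (shift b f m) (shift a f m) (shift a (shift b f) m))
    (cong (λ x → 1ℤ ℤ.* E b f m ℤ.+ -1ℤ ℤ.* x) (sym (shift-linear a 1ℤ -1ℤ f (shift b f) m))))
    where
    ring : ∀ x y z w → -1ℤ ℤ.* (-1ℤ ℤ.* x ℤ.+ 1ℤ ℤ.* y) ℤ.+ 1ℤ ℤ.* (-1ℤ ℤ.* z ℤ.+ 1ℤ ℤ.* w)
      ≡ 1ℤ ℤ.* (1ℤ ℤ.* x ℤ.+ -1ℤ ℤ.* y) ℤ.+ -1ℤ ℤ.* (1ℤ ℤ.* z ℤ.+ -1ℤ ℤ.* w)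
    ring = solve-∀

  M-value : ∀ n (f : Poly) m → M n f m ≡ shift n f m ℤ.- f m
  M-value n f m = ring (f m) (shift n f m)
    where
    ring : ∀ x y → -1ℤ ℤ.* x ℤ.+ 1ℤ ℤ.* y ≡ y ℤ.- x
    ring = solve-∀

P-cong : ∀ n {f g : Poly} → f ≗ g → P n f ≗ P n g
P-cong = binom-cong 1ℤ 1ℤ

P-E-comm : ∀ m n (f : Poly) → P m (E n f) ≗ E n (P m f)
P-E-comm m n = binom-comm 1ℤ 1ℤ m 1ℤ -1ℤ n

M-cong : ∀ n {f g : Poly} → f ≗ g → M n f ≗ M n g
M-cong = binom-cong -1ℤ 1ℤ

-- With p and q odd, z ↦ -z turns every 1 - z^a in the equation of Q_{p,q} into 1 + z^a. Multiplying
-- by the corresponding 1 - z^a gives factors 1 - z^{2a}, and the equation of F at s = 2 results.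
F2-alternate : ∀ {p q} → 1 ≤ p → 1 ≤ q → sgn p ≡ -1ℤ → sgn q ≡ -1ℤ →
  alternate (binary p q) ≗ F p q 2
F2-alternate {p} {q} 1≤p 1≤q oddp oddq = F-unique 1≤p 1≤q (s≤s z≤n) (λ m →
  trans (E-cong (p * q) step m)
  (trans (Es-↭ (P (p * q) δ) outer m)
  (Es-cong (2 ∷ q ∷ p ∷ []) (E-P (p * q) δ) m)))
  where
  d : Poly
  d = alternate (binary p q)
  alternate-δ : alternate δ ≗ δ
  alternate-δ zero    = refl
  alternate-δ (suc n) = ℤP.*-zeroʳ (sgn (suc n))
  alternate-cong : ∀ {f g : Poly} → f ≗ g → alternate f ≗ alternate g
  alternate-cong h n = cong (λ x → sgn n ℤ.* x) (h n)
  d-equation : P q (P p d) ≗ P 1 (P (p * q) δ)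
  d-equation m = trans (P-cong q (λ n → sym (alternate-E (binary p q) oddp n)) m)
    (trans (sym (alternate-E (E p (binary p q)) oddq m))
    (trans (alternate-cong (binary-equation 1≤p 1≤q (≤-refl {1})) m)
    (trans (alternate-E {1} (E (p * q) δ) refl m)
    (P-cong 1 (λ n → trans (alternate-E δ (trans (sgn-* p q oddq) oddp) n) (P-cong (p * q) alternate-δ n)) m))))
  step : E (2 * q) (E (2 * p) (E 1 d)) ≗ E q (E p (E 2 (P (p * q) δ)))
  step m = trans (sym (E-P q (E (2 * p) (E 1 d)) m)) (E-cong q (λ i →
    trans (P-cong q (λ j → sym (E-P p (E 1 d) j)) i)
    (trans (P-E-comm q p (P p (E 1 d)) i) (E-cong p (λ j →
      trans (P-cong q (P-E-comm p 1 d) j)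
      (trans (P-E-comm q 1 (P p d) j)
      (trans (E-cong 1 d-equation j) (E-P 1 (P (p * q) δ) j)))) i))) m)
  outer : p * q ∷ q ∷ p ∷ 2 ∷ [] ↭ 2 ∷ q ∷ p ∷ p * q ∷ []
  outer = ↭-trans (PermP.shift 2 (p * q ∷ q ∷ p ∷ []) [])
    (prep 2 (↭-sym (PermP.shift (p * q) (q ∷ p ∷ []) [])))

E-zero : ∀ {n} (f : Poly) → 1 ≤ n → E n f 0 ≡ f 0
E-zero {n} f 1≤n = trans (E-value n f 0)
  (trans (cong (λ x → f 0 ℤ.- x) (shift-< f 1≤n)) (ℤP.+-identityʳ (f 0)))

Es-zero : ∀ {ns} (f : Poly) → All (1 ≤_) ns → Es ns f 0 ≡ f 0
Es-zero f []           = refl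
Es-zero {n ∷ ns} f (1≤n ∷ all) = trans (E-zero (Es ns f) 1≤n) (Es-zero f all)

-- All factors have constant term 1. This provides the lower bound at s = 2, where the convention
-- gives the value 1.
F-zero : ∀ {p q s} → 1 ≤ p → 1 ≤ q → 1 ≤ s → F p q s 0 ≡ 1ℤ
F-zero {p} {q} {s} 1≤p 1≤q 1≤s = trans
  (sym (Es-zero (F p q s) (*-mono-≤ 1≤p 1≤q ∷ *-mono-≤ 1≤s 1≤q ∷ *-mono-≤ 1≤s 1≤p ∷ ≤-refl ∷ [])))
  (trans (F-equation 1≤p 1≤q 1≤s 0)
  (Es-zero δ (1≤s ∷ 1≤q ∷ 1≤p ∷ *-mono-≤ 1≤s (*-mono-≤ 1≤p 1≤q) ∷ [])))

-- Qpoly is the power series F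

⊛-act : ∀ (f g : Poly) → f ⊛ g ≗ f ⟨z^ 1 ⟩· g
⊛-act f g m = trans (sum-cong (suc m) (λ { i (s≤s i≤m) → cong (λ x → f i ℤ.* x)
    (sym (trans (cong (λ k → shift k g m) (*-identityˡ i)) (shift-∸ g i≤m))) }))
  (act-extend f g (≤-refl {1}) ≤-refl)

zpowMinusOne-M : ∀ {n} → 1 ≤ n → zpowMinusOne n ≗ M n δ
zpowMinusOne-M {suc n} _ i = trans (cases i) (sym (M-value (suc n) δ i))
  where
  monomial : ∀ n i → (if i ≡ᵇ n then 1ℤ else 0ℤ) ≡ shift n δ i
  monomial zero    zero    = refl
  monomial zero    (suc i) = refl
  monomial (suc n) zero    = refl
  monomial (suc n) (suc i) = monomial n i
  cases : ∀ i → zpowMinusOne (suc n) i ≡ shift (suc n) δ i ℤ.- δ i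
  cases zero    = refl
  cases (suc i) = trans (monomial n i) (sym (ℤP.+-identityʳ (shift n δ i)))

⊛-zpowMinusOne : ∀ {n f g} → 1 ≤ n → f ≗ g → f ⊛ zpowMinusOne n ≗ M n g
⊛-zpowMinusOne {n} {f} {g} 1≤n f≗g m = trans (⊛-act f (zpowMinusOne n) m)
  (trans (act-cong 1 f≗g (zpowMinusOne-M 1≤n) m)
  (trans (act-binomʳ -1ℤ 1ℤ n g δ (≤-refl {1}) m)
  (M-cong n (act-δʳ g) m)))

VanishesAbove : ℕ → Poly → Set
VanishesAbove N f = ∀ i → N < i → f i ≡ 0ℤ

vanishesAbove-M : ∀ {N f} n → VanishesAbove N f → VanishesAbove (N + n) (M n f)
vanishesAbove-M {N} {f} n v i N+n<i = trans (M-value n f i)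
  (cong₂ ℤ._-_ (shift-vanish n {suc N} v i (subst (_≤ i) (trans (cong suc (+-comm N n)) (sym (+-suc n N))) N+n<i))
               (v i (≤-<-trans (m≤m+n N n) N+n<i)))

vanishes-M : ∀ {f} n → Vanishes f → Vanishes (M n f)
vanishes-M {f} n (N , v) = n + N , λ i le → trans (M-value n f i)
  (cong₂ ℤ._-_ (shift-vanish n v i le) (v i (≤-trans (m≤n+m N n) le)))

module _ {n B : ℕ} {f g : Poly} (1≤n : 1 ≤ n) (f≗Mg : f ≗ M n g) (g-vanishes : Vanishes g) (f-above : VanishesAbove B f) where

  private
    f-step : ∀ x → f (n + x) ≡ g x ℤ.- g (n + x)
    f-step x = trans (f≗Mg (n + x)) (trans (M-value n g (n + x)) (cong (λ y → y ℤ.- g (n + x)) (shift-hit n g x)))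

    periodic : PeriodicFrom B n g
    periodic x B≤x = ℤP.i-j≡0⇒i≡j (g (n + x)) (g x) (trans (flip (g (n + x)) (g x))
      (cong ℤ.-_ (trans (sym (f-step x)) (f-above (n + x) (+-mono-≤ 1≤n B≤x)))))
      where
      flip : ∀ x y → x ℤ.- y ≡ ℤ.- (y ℤ.- x)
      flip = solve-∀

  -- Above B the equation makes g n-periodic, and g vanishes far out, so it vanishes from B on. This
  -- restores the degree bound for the next division.
  quotient-vanishes : ∀ x → B ≤ x → g x ≡ 0ℤ
  quotient-vanishes x B≤x = let N , v = g-vanishes in trans (sym (periodic-* N {f = g} periodic x B≤x))
    (v (N * n + x) (≤-trans (≤-reflexive (sym (*-identityʳ N))) (≤-trans (*-monoʳ-≤ N 1≤n) (m≤m+n (N * n) x))))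

  -- The truncated sum telescopes to g_j - g_{j + Bn}, and the second term vanishes because j + Bn ≥
  -- B.
  divZpowMinusOne-exact : divZpowMinusOne B n f ≗ g
  divZpowMinusOne-exact j = trans (telescope B)
    (trans (cong (λ x → g j ℤ.- x) (quotient-vanishes (j + B * n) B≤)) (ℤP.+-identityʳ (g j)))
    where
    B≤ : B ≤ j + B * n
    B≤ = ≤-trans (≤-reflexive (sym (*-identityʳ B))) (≤-trans (*-monoʳ-≤ B 1≤n) (m≤n+m (B * n) j))
    telescope : ∀ K → sumBelow K (λ k → f (j + suc k * n)) ≡ g j ℤ.- g (j + K * n)
    telescope zero    = sym (trans (cong (λ x → g j ℤ.- g x) (+-identityʳ j)) (ℤP.+-inverseʳ (g j)))
    telescope (suc K) = trans (cong₂ ℤ._+_ (telescope K) (trans (cong f (index j n (K * n))) (f-step (j + K * n))))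
      (trans (ring (g j) (g (j + K * n)) (g (n + (j + K * n)))) (cong (λ x → g j ℤ.- g x) (sym (index j n (K * n)))))
      where
      index : ∀ j n x → j + (n + x) ≡ n + (j + x)
      index = ℕSolver.solve-∀
      ring : ∀ x y z → (x ℤ.- y) ℤ.+ (y ℤ.- z) ≡ x ℤ.- z
      ring = solve-∀

module _ {p q r : ℕ} (1≤p : 1 ≤ p) (1≤q : 1 ≤ q) (1≤r : 1 ≤ r)
         (cpq : Coprime p q) (cqr : Coprime q r) (crp : Coprime r p) where

  private
    B : ℕ
    B = numDeg p q r

    -- The expected quotients after one, two and three divisions, built backwards from F.
    numer G₁ G₂ G₃ : Poly
    numer = ((zpowMinusOne (p * q * r) ⊛ zpowMinusOne p) ⊛ zpowMinusOne q) ⊛ zpowMinusOne r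
    G₃ = M 1 (F p q r)
    G₂ = M (r * p) G₃
    G₁ = M (q * r) G₂

    numer≗ : numer ≗ M r (M q (M p (M (p * q * r) δ)))
    numer≗ = ⊛-zpowMinusOne 1≤r (⊛-zpowMinusOne 1≤q (⊛-zpowMinusOne 1≤p
      (zpowMinusOne-M (*-mono-≤ (*-mono-≤ 1≤p 1≤q) 1≤r))))

    numer-above : VanishesAbove B numer
    numer-above i B<i = trans (numer≗ i) (vanishesAbove-M r (vanishesAbove-M q (vanishesAbove-M p
      (vanishesAbove-M {0} (p * q * r) δ-above))) i B<i)
      where
      δ-above : VanishesAbove 0 δ
      δ-above (suc i) _ = refl

    -- Each side has four factors z^n - 1, so passing to 1 - z^n changes signs in pairs and
    -- `F-equation` applies.
    numer-factors : numer ≗ M (p * q) G₁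
    numer-factors m = trans (numer≗ m)
      (trans (M-M r q _ m)
      (trans (Es-cong (r ∷ q ∷ []) (M-M p (p * q * r) δ) m)
      (trans (cong (λ k → Es (r ∷ q ∷ p ∷ k ∷ []) δ m) (*-comm (p * q) r))
      (trans (sym (F-equation 1≤p 1≤q 1≤r m))
      (trans (cong (λ k → Es (p * q ∷ k ∷ r * p ∷ 1 ∷ []) (F p q r) m) (*-comm r q))
      (trans (Es-cong (p * q ∷ q * r ∷ []) (λ n → sym (M-M (r * p) 1 (F p q r) n)) m)
      (sym (M-M (p * q) (q * r) G₂ m))))))))

    F-van : Vanishes (F p q r)
    F-van = F-vanishes 1≤p 1≤q 1≤r cpq cqr crp

    D₁ D₂ D₃ : Poly
    D₁ = divZpowMinusOne B (p * q) numer
    D₂ = divZpowMinusOne B (q * r) D₁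
    D₃ = divZpowMinusOne B (r * p) D₂

    above : ∀ {d g} → d ≗ g → (∀ x → B ≤ x → g x ≡ 0ℤ) → VanishesAbove B d
    above d≗g v i B<i = trans (d≗g i) (v i (<⇒≤ B<i))

    V₃ : Vanishes G₃
    V₃ = vanishes-M 1 F-van
    V₂ : Vanishes G₂
    V₂ = vanishes-M (r * p) V₃
    V₁ : Vanishes G₁
    V₁ = vanishes-M (q * r) V₂

    1≤pq : 1 ≤ p * q
    1≤pq = *-mono-≤ 1≤p 1≤q
    1≤qr : 1 ≤ q * r
    1≤qr = *-mono-≤ 1≤q 1≤r
    1≤rp : 1 ≤ r * p
    1≤rp = *-mono-≤ 1≤r 1≤p

    D₁≗ : D₁ ≗ G₁
    D₁≗ = divZpowMinusOne-exact 1≤pq numer-factors V₁ numer-above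
    D₁-above : VanishesAbove B D₁
    D₁-above = above D₁≗ (quotient-vanishes 1≤pq numer-factors V₁ numer-above)
    D₂≗ : D₂ ≗ G₂
    D₂≗ = divZpowMinusOne-exact 1≤qr D₁≗ V₂ D₁-above
    D₂-above : VanishesAbove B D₂
    D₂-above = above D₂≗ (quotient-vanishes 1≤qr D₁≗ V₂ D₁-above)
    D₃≗ : D₃ ≗ G₃
    D₃≗ = divZpowMinusOne-exact 1≤rp D₂≗ V₃ D₂-above
    D₃-above : VanishesAbove B D₃
    D₃-above = above D₃≗ (quotient-vanishes 1≤rp D₂≗ V₃ D₂-above)

  Qpoly≗F : Qpoly p q r ≗ F p q r
  Qpoly≗F = divZpowMinusOne-exact (≤-refl {1}) D₃≗ F-van D₃-above

  F-above : ∀ m → numDeg p q r ≤ m → F p q r m ≡ 0ℤ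
  F-above = quotient-vanishes (≤-refl {1}) D₃≗ F-van D₃-above

-- The height as the least bound for the coefficients of F

foldr-⊔-upper : ∀ (f : ℕ → ℕ) {x} xs → x ∈ xs → f x ≤ foldr _⊔_ 0 (map f xs)
foldr-⊔-upper f (y ∷ xs) (here refl)  = m≤m⊔n (f y) _
foldr-⊔-upper f (y ∷ xs) (there x∈xs) = ≤-trans (foldr-⊔-upper f xs x∈xs) (m≤n⊔m (f y) _)

foldr-⊔-least : ∀ (f : ℕ → ℕ) {b} xs → (∀ x → f x ≤ b) → foldr _⊔_ 0 (map f xs) ≤ b
foldr-⊔-least f []       h = z≤n
foldr-⊔-least f (y ∷ xs) h = ⊔-lub (h y) (foldr-⊔-least f xs h)

PairwiseCoprime : ℕ → ℕ → ℕ → Set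
PairwiseCoprime p q r = Coprime p q × Coprime q r × Coprime r p

Apoly-upper : ∀ {p q r} → 1 ≤ p → 1 ≤ q → 1 ≤ r → PairwiseCoprime p q r → ∀ n → ℤ.∣ F p q r n ∣ ≤ Apoly p q r
Apoly-upper {p} {q} {r} 1≤p 1≤q 1≤r (cpq , cqr , crp) n with n <? suc (numDeg p q r)
... | yes n< = subst (λ x → ℤ.∣ x ∣ ≤ Apoly p q r) (Qpoly≗F 1≤p 1≤q 1≤r cpq cqr crp n)
        (foldr-⊔-upper (λ m → ℤ.∣ Qpoly p q r m ∣) (upTo (suc (numDeg p q r))) (∈-upTo⁺ n<))
... | no  n≮ = subst (λ x → ℤ.∣ x ∣ ≤ Apoly p q r)
        (sym (F-above 1≤p 1≤q 1≤r cpq cqr crp n (≤-trans (n≤1+n (numDeg p q r)) (≮⇒≥ n≮)))) z≤n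

Apoly-least : ∀ {p q r b} → 1 ≤ p → 1 ≤ q → 1 ≤ r → PairwiseCoprime p q r →
  (∀ n → ℤ.∣ F p q r n ∣ ≤ b) → Apoly p q r ≤ b
Apoly-least {p} {q} {r} {b} 1≤p 1≤q 1≤r (cpq , cqr , crp) h =
  foldr-⊔-least (λ m → ℤ.∣ Qpoly p q r m ∣) (upTo (suc (numDeg p q r))) (λ m →
    subst (λ x → ℤ.∣ x ∣ ≤ b) (sym (Qpoly≗F 1≤p 1≤q 1≤r cpq cqr crp m)) (h m))

pairwise-swap : ∀ {p q r} → PairwiseCoprime p q r → PairwiseCoprime q p r
pairwise-swap (cpq , cqr , crp) = Coprimality.sym cpq , Coprimality.sym crp , Coprimality.sym cqr

Apoly-swap : ∀ {p q r} → 1 ≤ p → 1 ≤ q → 1 ≤ r → PairwiseCoprime p q r → Apoly q p r ≡ Apoly p q r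
Apoly-swap {p} {q} {r} 1≤p 1≤q 1≤r cop = ≤-antisym
  (Apoly-least 1≤q 1≤p 1≤r (pairwise-swap cop) (λ n →
    subst (λ x → ℤ.∣ x ∣ ≤ Apoly p q r) (sym (F-swap 1≤p 1≤q 1≤r n)) (Apoly-upper 1≤p 1≤q 1≤r cop n)))
  (Apoly-least 1≤p 1≤q 1≤r cop (λ n →
    subst (λ x → ℤ.∣ x ∣ ≤ Apoly q p r) (F-swap 1≤p 1≤q 1≤r n) (Apoly-upper 1≤q 1≤p 1≤r (pairwise-swap cop) n)))

A-swap : ∀ {p q r} → 1 ≤ p → 1 ≤ q → PairwiseCoprime p q r → A q p r ≡ A p q r
A-swap {r = zero}                _ _ _ = refl
A-swap {r = suc zero}            _ _ _ = refl
A-swap {r = suc (suc zero)}      _ _ _ = refl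
A-swap {r = suc (suc (suc r))} 1≤p 1≤q cop = Apoly-swap 1≤p 1≤q (s≤s z≤n) cop

A≡Apoly : ∀ p q {r} → 3 ≤ r → A p q r ≡ Apoly p q r
A≡Apoly p q (s≤s (s≤s (s≤s _))) = refl

-- Comparison of r and s congruent up to sign modulo pq

Residue : (b r s : ℕ) → Set
Residue b r s = (∃[ m ] r ≡ s + m * b) ⊎ (∃[ m ] r + s ≡ m * b)

residue-divides : ∀ {b r s d} → Residue b r s → d ∣ b → d ∣ s → d ∣ r
residue-divides {d = d} (inj₁ (m , eq)) d∣b d∣s = subst (d ∣_) (sym eq) (∣m∣n⇒∣m+n d∣s (∣-trans d∣b (n∣m*n m)))
residue-divides {r = r} {s} {d} (inj₂ (m , eq)) d∣b d∣s =
  ∣m+n∣m⇒∣n (subst (d ∣_) (trans (sym eq) (+-comm r s)) (∣-trans d∣b (n∣m*n m))) d∣s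

-- A common divisor of s and p or q divides pq, hence also r.
coprime-residue : ∀ {p q r s} → PairwiseCoprime p q r → Residue (p * q) r s → PairwiseCoprime p q s
coprime-residue {p} {q} (cpq , cqr , crp) residue = cpq
  , (λ (d∣q , d∣s) → cqr (d∣q , residue-divides residue (∣-trans d∣q (n∣m*n p)) d∣s))
  , (λ (d∣s , d∣p) → crp (residue-divides residue (∣-trans d∣p (m∣m*n q)) d∣s , d∣p))

module Congruent {p q r s : ℕ} (3≤p : 3 ≤ p) (p<q : p < q) (q<r : q < r) (1≤s : 1 ≤ s) (s<q : s < q)
            (cop-r : PairwiseCoprime p q r)
            (residue : Residue (p * q) r s) where

  1≤p : 1 ≤ p
  1≤p = ≤-trans (s≤s z≤n) 3≤p
  1≤r : 1 ≤ r
  1≤r = ≤-trans (≤-trans 1≤p (<⇒≤ p<q)) (<⇒≤ q<r)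

  -- This is where p ≥ 3 enters: p + 2q ≤ 3q ≤ pq. The spare q leaves room for the reflected
  -- remainder in `Fs-in-Fr`.
  2q+p≤pq : p + q + q ≤ p * q
  2q+p≤pq = ≤-trans (+-monoˡ-≤ q (+-monoˡ-≤ q (<⇒≤ p<q))) (≤-trans (≤-reflexive (triple q)) (*-monoˡ-≤ q 3≤p))
    where
    triple : ∀ q → q + q + q ≡ 3 * q
    triple = ℕSolver.solve-∀

  p+q≤pq : p + q ≤ p * q
  p+q≤pq = ≤-trans (m≤m+n (p + q) q) 2q+p≤pq

  open Residues {p} {q} 1≤p p<q p+q≤pq

  cpq : Coprime p q
  cpq = proj₁ cop-r

  cop-s : PairwiseCoprime p q s
  cop-s = coprime-residue cop-r residue

  -- The quotient k is kept and only the remainder changes. The new remainder has to be below r for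
  -- the truncated sum to be a coefficient of F at r.
  Fs-in-Fr : ∀ n → ∃[ n′ ] ℤ.∣ F p q s n ∣ ≡ ℤ.∣ F p q r n′ ∣
  Fs-in-Fr n = subst (λ n → ∃[ n′ ] ℤ.∣ F p q s n ∣ ≡ ℤ.∣ F p q r n′ ∣) (sym n≡) (found residue)
    where
    instance _ = >-nonZero 1≤s
    k t : ℕ
    k = n / s
    t = n % s
    t<s : t < s
    t<s = m%n<n n s
    n≡ : n ≡ s * k + t
    n≡ = trans (m≡m%n+[m/n]*n n s) (trans (+-comm t (k * s)) (cong (_+ t) (*-comm k s)))
    found : Residue (p * q) r s → ∃[ n′ ] ℤ.∣ F p q s (s * k + t) ∣ ≡ ℤ.∣ F p q r n′ ∣
    found (inj₁ (m , eq)) = r * k + t , cong ℤ.∣_∣ (trans (F≡S {p} {q} {s} {k} t<s)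
      (trans (sym (S-mod {r} {s} {m} {k} {t} eq)) (sym (F≡S {p} {q} {r} {k} (<-trans t<s (<-trans s<q q<r))))))
    found (inj₂ (m , eq)) = r * k + t′ , trans (cong ℤ.∣_∣ (F≡S {p} {q} {s} {k} t<s))
      (trans (sym (ℤP.∣-i∣≡∣i∣ (S p q s k t)))
      (cong ℤ.∣_∣ (trans (sym (S-reflect {r} {s} {m} {k} {t′} {t} 0 eq (trans sum (sym (+-identityʳ (p + q)))))) (sym (F≡S {p} {q} {r} {k} t′<r)))))
      where
      t′ : ℕ
      -- The mirror image p + q - 1 - t, a true subtraction because t < s < q.
      t′ = p + q ∸ suc t
      sum : suc (t′ + t) ≡ p + q
      sum = trans (sym (+-suc t′ t)) (m∸n+n≡m (≤-trans (<-trans t<s s<q) (m≤n+m q p)))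
      pq≤r+s : p * q ≤ r + s
      pq≤r+s = subst (p * q ≤_) (sym eq) (multiple m (subst (0 <_) eq (<-≤-trans 1≤r (m≤m+n r s))))
        where
        multiple : ∀ m → 0 < m * (p * q) → p * q ≤ m * (p * q)
        multiple (suc m) _ = m≤m+n (p * q) (m * (p * q))
      -- t′ < p + q ≤ pq - q ≤ pq - s ≤ r.
      t′<r : t′ < r
      t′<r = ≤-trans (subst (suc t′ ≤_) sum (s≤s (m≤m+n t′ t)))
        (+-cancelʳ-≤ s (p + q) r (≤-trans (+-monoʳ-≤ (p + q) (<⇒≤ s<q)) (≤-trans 2q+p≤pq pq≤r+s)))

  -- Remainders modulo r can exceed s, so the hypothesis must cover every t and not only those for
  -- which S at s is a coefficient.
  Fr-bound : ∀ {b} → (∀ k t → ℤ.∣ S p q s k t ∣ ≤ b) → Apoly p q r ≤ b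
  Fr-bound {b} h = Apoly-least 1≤p 1≤q 1≤r cop-r (λ n → subst (λ n → ℤ.∣ F p q r n ∣ ≤ b) (sym (n≡ n))
    (subst (λ x → ℤ.∣ x ∣ ≤ b) (sym (F≡S {p} {q} {r} {n / r} (m%n<n n r))) (bound (n / r) (n % r) residue)))
    where
    instance _ = >-nonZero 1≤r
    n≡ : ∀ n → n ≡ r * (n / r) + n % r
    n≡ n = trans (m≡m%n+[m/n]*n n r) (trans (+-comm (n % r) (n / r * r)) (cong (_+ n % r) (*-comm (n / r) r)))
    complement : ∀ t → ∃[ t′ ] suc (t + t′) ≡ (p + q) + t * (p * q)
    -- Any multiple of pq that leaves room to subtract t + 1 serves; t times pq is large enough.
    complement t = (p + q) + t * (p * q) ∸ suc t , m+[n∸m]≡n (+-mono-≤ (≤-trans 1≤p (m≤m+n p q))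
      (≤-trans (≤-reflexive (sym (*-identityʳ t))) (*-monoʳ-≤ t 1≤pq)))
    bound : ∀ k t → Residue (p * q) r s → ℤ.∣ S p q r k t ∣ ≤ b
    bound k t (inj₁ (m , eq)) = subst (λ x → ℤ.∣ x ∣ ≤ b) (sym (S-mod {r} {s} {m} {k} {t} eq)) (h k t)
    bound k t (inj₂ (m , eq)) = let t′ , sum = complement t in
      subst (_≤ b) (trans (sym (ℤP.∣-i∣≡∣i∣ (S p q s k t′))) (cong ℤ.∣_∣ (sym (S-reflect {r} {s} {m} {k} {t} {t′} t eq sum)))) (h k t′)

  Fr≤1+ : ∀ {b} → (∀ n → ℤ.∣ F p q s n ∣ ≤ b) → Apoly p q r ≤ b + 1
  Fr≤1+ h = Fr-bound (λ k t → S-bound cpq k t 1≤s h)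

  Fs≤Fr : Apoly p q s ≤ Apoly p q r
  Fs≤Fr = Apoly-least 1≤p 1≤q 1≤s cop-s (λ n → let n′ , eq = Fs-in-Fr n in
    subst (_≤ Apoly p q r) (sym eq) (Apoly-upper 1≤p 1≤q 1≤r cop-r n′))

  1≤Apoly : 1 ≤ Apoly p q r
  1≤Apoly = subst (_≤ Apoly p q r) (cong ℤ.∣_∣ (F-zero 1≤p 1≤q 1≤r)) (Apoly-upper 1≤p 1≤q 1≤r cop-r 0)

-- For s = 1, 2 the value of A is the convention and not `Apoly`, so only s ≥ 3 compares two
-- heights.
height-bounds : ∀ {p q r} s → 3 ≤ p → p < q → q < r → 1 ≤ s → s < q →
  PairwiseCoprime p q r → Residue (p * q) r s → A p q s ≤ Apoly p q r × Apoly p q r ≤ A p q s + 1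
height-bounds {p} {q} {r} (suc zero) 3≤p p<q q<r 1≤s s<q cop residue = z≤n , Fr-bound (S-bound-1 cpq)
  where open Congruent 3≤p p<q q<r 1≤s s<q cop residue
        open Residues {p} {q} 1≤p p<q p+q≤pq
height-bounds {p} {q} {r} (suc (suc zero)) 3≤p p<q q<r 1≤s s<q cop residue = 1≤Apoly , Fr≤1+ F2≤1
  where
  open Congruent 3≤p p<q q<r 1≤s s<q cop residue
  open Residues {p} {q} 1≤p p<q p+q≤pq
  F2≤1 : ∀ n → ℤ.∣ F p q 2 n ∣ ≤ 1
  F2≤1 n = subst (_≤ 1) (cong ℤ.∣_∣ (F2-alternate 1≤p 1≤q (coprime-2⇒sgn (proj₂ (proj₂ cop-s))) (coprime-2⇒sgn (Coprimality.sym (proj₁ (proj₂ cop-s)))) n))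
    (subst (_≤ 1) (sym (trans (ℤP.abs-* (sgn n) (binary p q n)) (trans (cong (_* ℤ.∣ binary p q n ∣) (∣sgn∣ n)) (*-identityˡ _))))
      (binary≤1 cpq n))
height-bounds {p} {q} {r} (suc (suc (suc s))) 3≤p p<q q<r 1≤s s<q cop residue =
  Fs≤Fr , Fr≤1+ (Apoly-upper 1≤p (≤-trans 1≤p (<⇒≤ p<q)) 1≤s cop-s)
  where open Congruent 3≤p p<q q<r 1≤s s<q cop residue

residue-of : ∀ {b r s} → s ≤ r → (b ∣ r ∸ s ⊎ b ∣ r + s) → Residue b r s
residue-of {s = s} s≤r (inj₁ (divides m eq)) = inj₁ (m , trans (sym (m+[n∸m]≡n s≤r)) (cong (s +_) eq))
residue-of s≤r (inj₂ (divides m eq)) = inj₂ (m , eq)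

ordered : ∀ {p q r s} → 3 ≤ p → p < q → 3 ≤ r → PairwiseCoprime p q r → 1 ≤ s →
  (p * q ∣ r ∸ s ⊎ p * q ∣ r + s) → q < r → s < q → A p q s ≤ A p q r × A p q r ≤ A p q s + 1
ordered {p} {q} {r} {s} 3≤p p<q 3≤r cop 1≤s div q<r s<q =
  subst (λ a → A p q s ≤ a × a ≤ A p q s + 1) (sym (A≡Apoly p q 3≤r))
    (height-bounds s 3≤p p<q q<r 1≤s s<q cop (residue-of (<⇒≤ (<-trans s<q q<r)) div))

mainTheorem1 : (p q r s : ℕ) →
    3 ≤ p → 3 ≤ q → 3 ≤ r →
    Coprime p q → Coprime q r → Coprime r p →
    1 ≤ s →
    (p * q ∣ r ∸ s ⊎ p * q ∣ r + s) →
    p ⊔ q < r → s < p ⊔ q →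
    A p q s ≤ A p q r × A p q r ≤ A p q s + 1
mainTheorem1 p q r s 3≤p 3≤q 3≤r cpq cqr crp 1≤s div p⊔q<r s<p⊔q with <-cmp p q
... | tri< p<q _ _ = ordered 3≤p p<q 3≤r (cpq , cqr , crp) 1≤s div
        (subst (_< r) (m≤n⇒m⊔n≡n (<⇒≤ p<q)) p⊔q<r) (subst (s <_) (m≤n⇒m⊔n≡n (<⇒≤ p<q)) s<p⊔q)
... | tri≈ _ refl _ = ⊥-elim (<⇒≱ 3≤p (≤-trans (≤-reflexive (cpq (∣-refl , ∣-refl))) (s≤s z≤n)))
-- Both heights are symmetric in p and q, so the roles are exchanged.
... | tri> _ _ q<p = subst₂ (λ a b → a ≤ b × b ≤ a + 1) (A-swap 1≤p 1≤q cop-s) (A-swap 1≤p 1≤q cop)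
        (ordered 3≤q q<p 3≤r (pairwise-swap cop) 1≤s (subst (λ b → b ∣ r ∸ s ⊎ b ∣ r + s) (*-comm p q) div)
          (subst (_< r) (m≥n⇒m⊔n≡m (<⇒≤ q<p)) p⊔q<r) (subst (s <_) (m≥n⇒m⊔n≡m (<⇒≤ q<p)) s<p⊔q))
  where
  1≤p : 1 ≤ p
  1≤p = ≤-trans (s≤s z≤n) 3≤p
  1≤q : 1 ≤ q
  1≤q = ≤-trans (s≤s z≤n) 3≤q
  cop : PairwiseCoprime p q r
  cop = cpq , cqr , crp
  cop-s : PairwiseCoprime p q s
  cop-s = coprime-residue cop (residue-of (<⇒≤ (<-trans s<p⊔q p⊔q<r)) div)
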